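{- Let $\epsilon>0$ be a constant. Given any non-negative submodular function $f:2^V\to\mathbb{R}_{\ge0}$ on a finite set $V$ and an integer $0\le c\le|V|$, there is a polynomial-time $\left(\frac16-\epsilon\right)$-approximation algorithm for the problem $$\max\{f(S)\ :\ S\subseteq V,\ |S|=c\},$$ i.e. an algorithm returning $S\subseteq V$ with $|S|=c$ and $f(S)\ge\left(\frac16-\epsilon\right)\max\{f(T): T\subseteq V,\ |T|=c\}$.
   Context: A function $f:2^V\to\mathbb{R}$ is submodular if $f(S\cup T)+f(S\cap T)\le f(S)+f(T)$ for all $S,T\subseteq V$ (it need not be monotone). The function $f$ is accessed through a value oracle (given $S$, returns $f(S)$); oracle calls count as single steps, and polynomial time means polynomial in the input size for fixed $\epsilon$. -}

module Defs where

open import Level using (0ℓ)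
open import Algebra.Bundles using (CommutativeRing)
open import Data.Bool.Base as Bool using (Bool; true; false)
open import Data.Fin.Subset using (Subset; inside; outside; ⊥; _∪_; _∩_; ∣_∣)
open import Data.Nat.Base as ℕ using (ℕ; zero; suc; _≡ᵇ_; _≤ᵇ_; _∸_)
open import Data.Product.Base using (_×_; ∃)
open import Data.Vec.Base using ([]; _∷_)
open import Relation.Binary.Core using (Rel)
open import Relation.Binary.PropositionalEquality.Core using (_≡_)
open import Relation.Binary.Structures using (IsDecTotalOrder)
open import Relation.Nullary.Decidable.Core using (⌊_⌋)
open import Relation.Nullary.Negation.Core using (¬_)
open import Relation.Unary using (Pred)
import Algebra.Definitions.RawMonoid as RawMonoidDefinitions
import Relation.Binary.Construct.NonStrictToStrict as NonStrictToStrict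

------------------------------------------------------------------------
-- The real numbers

-- ℝ is axiomatised as a Dedekind-complete ordered field, which classically
-- determines it up to unique isomorphism.  The order is decidable, as it is
-- in classical mathematics, and 0⁻¹ is unspecified.  The Archimedean property
-- follows classically from completeness; it is a separate field because the
-- natural number it provides cannot be extracted constructively from suprema.

record Reals : Set₁ where
  infix  4 _≤_
  infix  8 _⁻¹
  field
    commutativeRing : CommutativeRing 0ℓ 0ℓ
  open CommutativeRing commutativeRing public
  field
    _≤_             : Rel Carrier 0ℓ
    isDecTotalOrder : IsDecTotalOrder _≈_ _≤_
    0≉1             : ¬ 0# ≈ 1#
    _⁻¹             : Carrier → Carrier
    ⁻¹-inverseʳ     : ∀ x → ¬ x ≈ 0# → x * x ⁻¹ ≈ 1#
    +-monoˡ-≤       : ∀ z {x y} → x ≤ y → x + z ≤ y + z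
    *-nonNegative   : ∀ {x y} → 0# ≤ x → 0# ≤ y → 0# ≤ x * y

  open IsDecTotalOrder isDecTotalOrder public using (_≤?_)
  open NonStrictToStrict _≈_ _≤_ public using (_<_)
  open RawMonoidDefinitions +-rawMonoid public using () renaming (_×_ to _·_)

  field
    archimedean : ∀ x → ∃ λ n → x ≤ n · 1#
    supremum    : (P : Pred Carrier 0ℓ) →
                  ∃ P → (∃ λ u → ∀ x → P x → x ≤ u) →
                  ∃ λ s → (∀ x → P x → x ≤ s) ×
                          (∀ u → (∀ x → P x → x ≤ u) → s ≤ u)

------------------------------------------------------------------------
-- Set functions

module _ (ℝ : Reals) where
  open Reals ℝ

  SetFunction : ℕ → Set
  SetFunction n = Subset n → Carrier

  module _ {n} (f : SetFunction n) where

    NonNegative : Set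
    NonNegative = ∀ S → 0# ≤ f S

    Submodular : Set
    Submodular = ∀ S T → f (S ∪ T) + f (S ∩ T) ≤ f S + f T

    IsMaximumOver : Pred (Subset n) 0ℓ → Pred Carrier 0ℓ
    IsMaximumOver P M = (∃ λ T → P T × f T ≈ M) × (∀ T → P T → f T ≤ M)

------------------------------------------------------------------------
-- A random access machine with a value oracle, programmed by while programs

-- There are three unbounded memories, addressed by ℕ: one of natural numbers,
-- one of real numbers and one of subsets of V.  Subsets behave as bit arrays,
-- accessed one element at a time.
--
-- At unit cost, numbers can only be added, subtracted and compared.  Thus t
-- steps produce natural numbers of O(t + log n) bits, and real numbers that are
-- integer combinations, with coefficients of O(t) bits, of oracle answers.
-- So polynomially many steps are also polynomial time on a Turing machine, up
-- to the size of the oracle answers, if these are rational.  With unit-cost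
-- multiplication this would fail, by repeated squaring.

data Ref : Set where
  cell : ℕ → Ref
  at   : ℕ → Ref     -- indirect: the address is in the given number cell

data Instruction : Set where
  const       : Ref → ℕ → Instruction
  copy        : Ref → Ref → Instruction
  add sub     : Ref → Ref → Ref → Instruction
  constʳ0     : Ref → Instruction
  copyʳ       : Ref → Ref → Instruction
  addʳ subʳ   : Ref → Ref → Ref → Instruction
  insert      : Ref → Ref → Instruction
  delete      : Ref → Ref → Instruction
  query       : Ref → Ref → Instruction

data Test : Set where
  leq  : Ref → Ref → Test
  leqʳ : Ref → Ref → Test
  mem  : Ref → Ref → Test

infixr 5 _⨾_
data Program : Set where
  skip          : Program
  exec          : Instruction → Program
  _⨾_           : Program → Program → Program
  if_then_else_ : Test → Program → Program → Program
  while_repeat_     : Test → Program → Program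

update : ∀ {A : Set} → (ℕ → A) → ℕ → A → (ℕ → A)
update m a v b = Bool.if a ≡ᵇ b then v else m b

-- A number that is not below n denotes no element of V = Fin n: writing such
-- an element has no effect and it is a member of no subset.

write : ∀ {n} → Bool → ℕ → Subset n → Subset n
write b i       []      = []
write b zero    (_ ∷ S) = b ∷ S
write b (suc i) (x ∷ S) = x ∷ write b i S

member : ∀ {n} → ℕ → Subset n → Bool
member i       []      = false
member zero    (x ∷ S) = x
member (suc i) (x ∷ S) = member i S

module Machine (ℝ : Reals) {n : ℕ} (f : SetFunction ℝ n) where
  open Reals ℝ

  record State : Set where
    field
      nat  : ℕ → ℕ
      real : ℕ → Carrier
      set  : ℕ → Subset n
  open State public

  initial : ℕ → State
  initial c = record
    { nat  = λ { 0 → n ; 1 → c ; _ → 0 }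
    ; real = λ _ → 0#
    ; set  = λ _ → ⊥
    }

  output : State → Subset n
  output s = set s 0

  address : State → Ref → ℕ
  address s (cell a) = a
  address s (at a)   = nat s a

  natAt : State → Ref → ℕ
  natAt s r = nat s (address s r)

  realAt : State → Ref → Carrier
  realAt s r = real s (address s r)

  setAt : State → Ref → Subset n
  setAt s r = set s (address s r)

  putNat : State → Ref → ℕ → State
  putNat s r v = record s { nat = update (nat s) (address s r) v }

  putReal : State → Ref → Carrier → State
  putReal s r v = record s { real = update (real s) (address s r) v }

  putSet : State → Ref → Subset n → State
  putSet s r v = record s { set = update (set s) (address s r) v }

  step : Instruction → State → State
  step (const r k)    s = putNat s r k
  step (copy r p)     s = putNat s r (natAt s p)
  step (add r p q)    s = putNat s r (natAt s p ℕ.+ natAt s q)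
  step (sub r p q)    s = putNat s r (natAt s p ∸ natAt s q)
  step (constʳ0 r)    s = putReal s r 0#
  step (copyʳ r p)    s = putReal s r (realAt s p)
  step (addʳ r p q)   s = putReal s r (realAt s p + realAt s q)
  step (subʳ r p q)   s = putReal s r (realAt s p - realAt s q)
  step (insert X i)   s = putSet s X (write inside (natAt s i) (setAt s X))
  step (delete X i)   s = putSet s X (write outside (natAt s i) (setAt s X))
  step (query r X)    s = putReal s r (f (setAt s X))

  test : Test → State → Bool
  test (leq p q)  s = natAt s p ≤ᵇ natAt s q
  test (leqʳ p q) s = ⌊ realAt s p ≤? realAt s q ⌋
  test (mem i X)  s = member (natAt s i) (setAt s X)

  -- ⟨ p , s ⟩⇓ s′ [ t ]: started in s, p halts in s′ after t steps, where each
  -- instruction and each evaluation of a test is one step.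

  data ⟨_,_⟩⇓_[_] : Program → State → State → ℕ → Set where
    skip  : ∀ {s} → ⟨ skip , s ⟩⇓ s [ 0 ]
    exec  : ∀ {i s} → ⟨ exec i , s ⟩⇓ step i s [ 1 ]
    seq   : ∀ {p q s s′ s″ t u} →
            ⟨ p , s ⟩⇓ s′ [ t ] → ⟨ q , s′ ⟩⇓ s″ [ u ] →
            ⟨ p ⨾ q , s ⟩⇓ s″ [ t ℕ.+ u ]
    then′ : ∀ {b p q s s′ t} → test b s ≡ true →
            ⟨ p , s ⟩⇓ s′ [ t ] →
            ⟨ if b then p else q , s ⟩⇓ s′ [ suc t ]
    else′ : ∀ {b p q s s′ t} → test b s ≡ false →
            ⟨ q , s ⟩⇓ s′ [ t ] →
            ⟨ if b then p else q , s ⟩⇓ s′ [ suc t ]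
    stop  : ∀ {b p s} → test b s ≡ false →
            ⟨ while b repeat p , s ⟩⇓ s [ 1 ]
    loop  : ∀ {b p s s′ s″ t u} → test b s ≡ true →
            ⟨ p , s ⟩⇓ s′ [ t ] → ⟨ while b repeat p , s′ ⟩⇓ s″ [ u ] →
            ⟨ while b repeat p , s ⟩⇓ s″ [ suc (t ℕ.+ u) ]

------------------------------------------------------------------------
-- Approximation algorithms for max { f S : S ⊆ V , ∣S∣ = c }

module _ (ℝ : Reals) where
  open Reals ℝ

  -- A single program must serve all n, f and c.  The size of an instance is
  -- taken to be n = ∣V∣, and every polynomial in n is at most C (n + 1)^d for
  -- some C and d.

  IsPolynomialTimeApproximation : Carrier → Program → Set
  IsPolynomialTimeApproximation α A =
    ∃ λ C → ∃ λ d →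
    ∀ n (f : SetFunction ℝ n) → NonNegative ℝ f → Submodular ℝ f →
    ∀ c → c ℕ.≤ n →
    let open Machine ℝ f in
    ∃ λ s → ∃ λ t →
      ⟨ A , initial c ⟩⇓ s [ t ] ×
      t ℕ.≤ C ℕ.* suc n ℕ.^ d ×
      ∣ output s ∣ ≡ c ×
      ∃ λ M → IsMaximumOver ℝ f (λ T → ∣ T ∣ ≡ c) M × α * M ≤ f (output s)

{-# OPTIONS --safe #-}

-- Let C be an optimal set.  If S is optimal under swaps, then
-- f (S ∪ C) + f (S ∩ C) ≤ 2 f S.  Let S₂ be optimal under the swaps that keep
-- it disjoint from S₁ (when 2c ≤ n), respectively a superset of ∁ S₁ (when
-- 2c ≥ n).  Then 2 f S₂ dominates f (S₂ ∪ (C ─ S₁)), respectively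
-- f (S₂ ∩ (C ∪ ∁ S₁)), and combining it with the inequality for S₁ gives
-- f C ≤ 2 f S₁ + 2 f S₂.  Thus exact local optima would give 1/4.
--
-- Instead of waiting for local optima, both searches make n + 1 best-improvement
-- steps, the second one anew for every S₁ met by the first one.  In a step from
-- S to S′ the inequalities hold up to an error c (f S′ − f S).  These errors
-- telescope, so averaged over a search they are at most the value B of the best
-- set found, and f C ≤ 4 B + B + B.
--
-- The best step need not be found exactly: by submodularity, swapping the best
-- deletion a for the best insertion b gains at least the sum of their marginal
-- gains, which is all that the analysis uses.
module Submission where

open import Defs
open import Data.Bool.Base as Bool using (Bool; true; false; _∧_; _∨_; not)
open import Data.Bool.Properties using (T-≡)
open import Data.Fin.Subset using (Subset; ⊥; _∪_; _∩_; _─_; ∣_∣)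
open import Data.Fin.Subset.Properties using (∩-comm; ∣⊥∣≡0)
open import Data.Nat.Base using (ℕ; zero; suc; z≤n; s≤s; _≡ᵇ_; _≤ᵇ_; _^_; _∸_)
  renaming (_+_ to _+ℕ_; _*_ to _*ℕ_; _≤_ to _≤ℕ_; _<_ to _<ℕ_)
import Data.Nat.Properties as ℕ
open import Data.Product.Base using (∃; _×_; _,_; proj₁; proj₂)
open import Data.Sum.Base using (_⊎_; inj₁; inj₂)
open import Data.Vec.Base using ([]; _∷_)
open import Function.Bundles using (Equivalence)
open import Relation.Binary.PropositionalEquality
open import Relation.Binary.Structures using (IsDecTotalOrder)
open import Relation.Nullary.Decidable.Core using (Dec; yes; no; ⌊_⌋)
open import Relation.Nullary.Negation using (¬_; contradiction)
import Algebra.Properties.Ring as RingProperties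
import Algebra.Solver.Ring.NaturalCoefficients.Default as SemiringSolver

-- Subsets as bit arrays

module _ where
  private variable
    n i j : ℕ
    b : Bool
    X Y : Subset n

  infix 4 _∈_ _∉_
  _∈_ _∉_ : ℕ → Subset n → Set
  i ∈ X = member i X ≡ true
  i ∉ X = member i X ≡ false

  member-∪ : ∀ i (X Y : Subset n) → member i (X ∪ Y) ≡ member i X ∨ member i Y
  member-∪ i       []      []      = refl
  member-∪ zero    (x ∷ X) (y ∷ Y) = refl
  member-∪ (suc i) (x ∷ X) (y ∷ Y) = member-∪ i X Y

  member-∩ : ∀ i (X Y : Subset n) → member i (X ∩ Y) ≡ member i X ∧ member i Y
  member-∩ i       []      []      = refl
  member-∩ zero    (x ∷ X) (y ∷ Y) = refl
  member-∩ (suc i) (x ∷ X) (y ∷ Y) = member-∩ i X Y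

  member-─ : ∀ i (X Y : Subset n) → member i (X ─ Y) ≡ member i X ∧ not (member i Y)
  member-─ i       []          []          = refl
  member-─ zero    (true  ∷ X) (true  ∷ Y) = refl
  member-─ zero    (true  ∷ X) (false ∷ Y) = refl
  member-─ zero    (false ∷ X) (true  ∷ Y) = refl
  member-─ zero    (false ∷ X) (false ∷ Y) = refl
  member-─ (suc i) (x ∷ X)     (y ∷ Y)     = member-─ i X Y

  member-⊥ : ∀ i → i ∉ ⊥ {n}
  member-⊥ {zero}  i       = refl
  member-⊥ {suc n} zero    = refl
  member-⊥ {suc n} (suc i) = member-⊥ {n} i

  -- Only indices below `n` are compared, since `member-write` is available only for those.
  member-ext : {X Y : Subset n} → (∀ i → i <ℕ n → member i X ≡ member i Y) → X ≡ Y
  member-ext {X = []}    {Y = []}    eq = refl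
  member-ext {X = x ∷ X} {Y = y ∷ Y} eq =
    cong₂ _∷_ (eq 0 (s≤s z≤n)) (member-ext λ i i<n → eq (suc i) (s≤s i<n))

  ∈⇒< : (X : Subset n) → i ∈ X → i <ℕ n
  ∈⇒< {i = zero}  (x ∷ X) i∈X = s≤s z≤n
  ∈⇒< {i = suc i} (x ∷ X) i∈X = s≤s (∈⇒< X i∈X)

  member-write : (X : Subset n) → i <ℕ n → member i (write b i X) ≡ b
  member-write {i = zero}  (x ∷ X) i<n       = refl
  member-write {i = suc i} (x ∷ X) (s≤s i<n) = member-write X i<n

  member-write-≢ : (X : Subset n) → i ≢ j → member j (write b i X) ≡ member j X
  member-write-≢                         []      i≢j = refl
  member-write-≢ {i = zero}  {j = zero}  (x ∷ X) i≢j = contradiction refl i≢j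
  member-write-≢ {i = zero}  {j = suc j} (x ∷ X) i≢j = refl
  member-write-≢ {i = suc i} {j = zero}  (x ∷ X) i≢j = refl
  member-write-≢ {i = suc i} {j = suc j} (x ∷ X) i≢j =
    member-write-≢ X λ eq → i≢j (cong suc eq)

  write-write : ∀ b b′ i (X : Subset n) → write b i (write b′ i X) ≡ write b i X
  write-write b b′ i       []      = refl
  write-write b b′ zero    (x ∷ X) = refl
  write-write b b′ (suc i) (x ∷ X) = cong (x ∷_) (write-write b b′ i X)

  write-member : ∀ i (X : Subset n) → write (member i X) i X ≡ X
  write-member i       []      = refl
  write-member zero    (x ∷ X) = refl
  write-member (suc i) (x ∷ X) = cong (x ∷_) (write-member i X)

  write-restore : ∀ b b′ i (X : Subset n) → member i X ≡ b → write b i (write b′ i X) ≡ X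
  write-restore _ b′ i X refl = trans (write-write _ b′ i X) (write-member i X)

  ∣insert∣ : (X : Subset n) → i <ℕ n → i ∉ X → ∣ write true i X ∣ ≡ suc ∣ X ∣
  ∣insert∣ {i = zero}  (false ∷ X) i<n       i∉X = refl
  ∣insert∣ {i = suc i} (true  ∷ X) (s≤s i<n) i∉X = cong suc (∣insert∣ X i<n i∉X)
  ∣insert∣ {i = suc i} (false ∷ X) (s≤s i<n) i∉X = ∣insert∣ X i<n i∉X

  ∣delete∣ : (X : Subset n) → i ∈ X → suc ∣ write false i X ∣ ≡ ∣ X ∣
  ∣delete∣ {i = zero}  (true  ∷ X) i∈X = refl
  ∣delete∣ {i = suc i} (true  ∷ X) i∈X = cong suc (∣delete∣ X i∈X)
  ∣delete∣ {i = suc i} (false ∷ X) i∈X = ∣delete∣ X i∈X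

  ∣∩∣+∣─∣ : (X Y : Subset n) → ∣ X ∩ Y ∣ +ℕ ∣ X ─ Y ∣ ≡ ∣ X ∣
  ∣∩∣+∣─∣ []          []          = refl
  ∣∩∣+∣─∣ (true  ∷ X) (true  ∷ Y) = cong suc (∣∩∣+∣─∣ X Y)
  ∣∩∣+∣─∣ (true  ∷ X) (false ∷ Y) = trans (ℕ.+-suc _ _) (cong suc (∣∩∣+∣─∣ X Y))
  ∣∩∣+∣─∣ (false ∷ X) (true  ∷ Y) = ∣∩∣+∣─∣ X Y
  ∣∩∣+∣─∣ (false ∷ X) (false ∷ Y) = ∣∩∣+∣─∣ X Y

  -- Supplies the arbitrary half of a balanced exchange whose other half is prescribed.
  subset-of-size : ∀ m (X : Subset n) → m ≤ℕ ∣ X ∣ →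
                   ∃ λ (Y : Subset n) → ∣ Y ∣ ≡ m × (∀ i → i ∈ Y → i ∈ X)
  subset-of-size {n} zero X m≤ =
    ⊥ , ∣⊥∣≡0 n , λ i i∈⊥ → contradiction (trans (sym i∈⊥) (member-⊥ {n} i)) λ ()
  subset-of-size (suc m) (true ∷ X) (s≤s m≤) =
    let Y , ∣Y∣≡m , Y⊆X = subset-of-size m X m≤ in
    true ∷ Y , cong suc ∣Y∣≡m , λ { zero _ → refl ; (suc i) → Y⊆X i }
  subset-of-size (suc m) (false ∷ X) m≤ =
    let Y , ∣Y∣≡m , Y⊆X = subset-of-size (suc m) X m≤ in
    false ∷ Y , ∣Y∣≡m , λ { zero () ; (suc i) → Y⊆X i }

  ∣X∣≡0⇒∉ : (X : Subset n) → ∣ X ∣ ≡ 0 → ∀ i → i ∉ X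
  ∣X∣≡0⇒∉ []          eq i       = refl
  ∣X∣≡0⇒∉ (false ∷ X) eq zero    = refl
  ∣X∣≡0⇒∉ (false ∷ X) eq (suc i) = ∣X∣≡0⇒∉ X eq i

  pick : ∀ {m} (X : Subset n) → ∣ X ∣ ≡ suc m → ∃ (_∈ X)
  pick (true  ∷ X) eq = 0 , refl
  pick (false ∷ X) eq = let i , i∈X = pick X eq in suc i , i∈X

  ∣∣-mono : (X Y : Subset n) → (∀ i → i ∈ X → i ∈ Y) → ∣ X ∣ ≤ℕ ∣ Y ∣
  ∣∣-mono []          []          X⊆Y = z≤n
  ∣∣-mono (true  ∷ X) (true  ∷ Y) X⊆Y = s≤s (∣∣-mono X Y λ i → X⊆Y (suc i))
  ∣∣-mono (true  ∷ X) (false ∷ Y) X⊆Y = contradiction (X⊆Y 0 refl) λ ()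
  ∣∣-mono (false ∷ X) (true  ∷ Y) X⊆Y = ℕ.m≤n⇒m≤1+n (∣∣-mono X Y λ i → X⊆Y (suc i))
  ∣∣-mono (false ∷ X) (false ∷ Y) X⊆Y = ∣∣-mono X Y λ i → X⊆Y (suc i)

  ∣full∣ : (X : Subset n) → (∀ i → i <ℕ n → i ∈ X) → ∣ X ∣ ≡ n
  ∣full∣ []          full = refl
  ∣full∣ (true  ∷ X) full = cong suc (∣full∣ X λ i i<n → full (suc i) (s≤s i<n))
  ∣full∣ (false ∷ X) full = contradiction (full 0 (s≤s z≤n)) λ ()

  ∣complement∣ : (X Y : Subset n) → (∀ i → i <ℕ n → member i Y ≡ not (member i X)) →
                 ∣ X ∣ +ℕ ∣ Y ∣ ≡ n
  ∣complement∣ []          []          _  = refl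
  ∣complement∣ (true  ∷ X) (true  ∷ Y) eq = contradiction (eq 0 (s≤s z≤n)) λ ()
  ∣complement∣ (false ∷ X) (false ∷ Y) eq = contradiction (eq 0 (s≤s z≤n)) λ ()
  ∣complement∣ (true  ∷ X) (false ∷ Y) eq =
    cong suc (∣complement∣ X Y λ i i<n → eq (suc i) (s≤s i<n))
  ∣complement∣ (false ∷ X) (true  ∷ Y) eq =
    trans (ℕ.+-suc _ _) (cong suc (∣complement∣ X Y λ i i<n → eq (suc i) (s≤s i<n)))

  ∣empty∣ : (X : Subset n) → (∀ i → i <ℕ n → i ∉ X) → ∣ X ∣ ≡ 0
  ∣empty∣ []          empty = refl
  ∣empty∣ (true  ∷ X) empty = contradiction (empty 0 (s≤s z≤n)) λ ()
  ∣empty∣ (false ∷ X) empty = ∣empty∣ X λ i i<n → empty (suc i) (s≤s i<n)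

  ∈∉⇒≢ : (X : Subset n) → i ∈ X → j ∉ X → i ≢ j
  ∈∉⇒≢ X i∈X j∉X refl = contradiction (trans (sym i∈X) j∉X) λ ()

-- Ordered fields

module OrderedField (ℝ : Reals) where
  open Reals ℝ renaming (refl to ≈-refl; sym to ≈-sym; trans to ≈-trans; reflexive to ≈-reflexive)
  open IsDecTotalOrder isDecTotalOrder public
    using (total; antisym) renaming (refl to ≤-refl; trans to ≤-trans; reflexive to ≤-reflexive)
  open RingProperties ring using (-‿distribˡ-*; -‿involutive)
  open SemiringSolver commutativeSemiring public using (solve; _:=_; _:+_; _:*_; con)

  +-mono-≤ : ∀ {w x y z} → w ≤ x → y ≤ z → w + y ≤ x + z
  +-mono-≤ {w} {x} {y} {z} w≤x y≤z =
    ≤-trans (+-monoˡ-≤ y w≤x)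
      (≤-trans (≤-reflexive (+-comm x y)) (≤-trans (+-monoˡ-≤ x y≤z) (≤-reflexive (+-comm z x))))

  +-cancelʳ-≤ : ∀ z {x y} → x + z ≤ y + z → x ≤ y
  +-cancelʳ-≤ z {x} {y} p =
    ≤-trans (≤-reflexive (≈-sym (cancel x))) (≤-trans (+-monoˡ-≤ (- z) p) (≤-reflexive (cancel y)))
    where
    cancel : ∀ x → x + z + - z ≈ x
    cancel x = ≈-trans (+-assoc x z (- z)) (≈-trans (+-congˡ (-‿inverseʳ z)) (+-identityʳ x))

  -- Linear inequalities are proved by adding hypotheses to L ≤ R and
  -- cancelling z; without subtraction, the side conditions are semiring
  -- identities.
  linear : ∀ {L R} z {x y} → L ≤ R → x + z ≈ L → R ≈ y + z → x ≤ y
  linear z L≤R x+z≈L R≈y+z =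
    +-cancelʳ-≤ z (≤-trans (≤-reflexive x+z≈L) (≤-trans L≤R (≤-reflexive R≈y+z)))

  0≤x-y : ∀ {x y} → y ≤ x → 0# ≤ x - y
  0≤x-y {x} {y} y≤x = ≤-trans (≤-reflexive (≈-sym (-‿inverseʳ y))) (+-monoˡ-≤ (- y) y≤x)

  x-y+y≈x : ∀ x y → x - y + y ≈ x
  x-y+y≈x x y = ≈-trans (+-assoc x (- y) y) (≈-trans (+-congˡ (-‿inverseˡ y)) (+-identityʳ x))

  *-monoˡ-≤ : ∀ {x y z} → 0# ≤ z → x ≤ y → z * x ≤ z * y
  *-monoˡ-≤ {x} {y} {z} 0≤z x≤y = linear 0# (+-mono-≤ (*-nonNegative 0≤z (0≤x-y x≤y)) (≤-refl {z * x}))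
    (≈-trans (+-identityʳ _) (≈-sym (+-identityˡ _)))
    (≈-trans (≈-sym (distribˡ z _ x)) (≈-trans (*-congˡ (x-y+y≈x y x)) (≈-sym (+-identityʳ _))))

  0≤1 : 0# ≤ 1#
  0≤1 with total 0# 1#
  ... | inj₁ 0≤1 = 0≤1
  ... | inj₂ 1≤0 = ≤-trans (*-nonNegative 0≤-1 0≤-1) (≤-reflexive -1*-1≈1)
    where
    0≤-1 : 0# ≤ - 1#
    0≤-1 = ≤-trans (0≤x-y 1≤0) (≤-reflexive (+-identityˡ (- 1#)))
    -1*-1≈1 : - 1# * - 1# ≈ 1#
    -1*-1≈1 = ≈-trans (≈-sym (-‿distribˡ-* 1# (- 1#)))
      (≈-trans (-‿cong (*-identityˡ (- 1#))) (-‿involutive 1#))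

  ι : ℕ → Carrier
  ι k = k · 1#

  0≤ι : ∀ k → 0# ≤ ι k
  0≤ι zero    = ≤-refl
  0≤ι (suc k) = ≤-trans (≤-reflexive (≈-sym (+-identityˡ 0#))) (+-mono-≤ 0≤1 (0≤ι k))

  ι-mono : ∀ {j k} → j ≤ℕ k → ι j ≤ ι k
  ι-mono {k = k} z≤n = 0≤ι k
  ι-mono (s≤s j≤k)   = +-mono-≤ ≤-refl (ι-mono j≤k)

  *-monoʳ-≤ : ∀ {x y z} → 0# ≤ z → x ≤ y → x * z ≤ y * z
  *-monoʳ-≤ {x} {y} {z} 0≤z x≤y = ≤-trans (≤-reflexive (*-comm x z))
    (≤-trans (*-monoˡ-≤ 0≤z x≤y) (≤-reflexive (*-comm z y)))

  -- No inverse is involved: if `y ≤ x`, then adding `ι k * y ≤ ι k * x` to the hypothesis and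
  -- cancelling leaves `x ≤ y`.
  ι-cancel : ∀ k {x y} → ι (suc k) * x ≤ ι (suc k) * y → x ≤ y
  ι-cancel k {x} {y} kx≤ky with total x y
  ... | inj₁ x≤y = x≤y
  ... | inj₂ y≤x = linear (ι k * x + ι k * y) (+-mono-≤ kx≤ky (*-monoˡ-≤ (0≤ι k) y≤x))
    (solve 3 (λ k x y → x :+ (k :* x :+ k :* y) := (con 1 :+ k) :* x :+ k :* y) ≈-refl (ι k) x y)
    (solve 3 (λ k x y → (con 1 :+ k) :* y :+ k :* x := y :+ (k :* x :+ k :* y)) ≈-refl (ι k) x y)

  -- If x_k is the value after k rounds and F ≤ D + m (x_{k+1} − x_k) in each
  -- round, then the gains telescope and F ≤ D + m x_k / k.
  Averaged : ℕ → Carrier → Carrier → ℕ → Carrier → Set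
  Averaged k F D m x = ι k * F ≤ ι k * D + ι m * x

  averaged-zero : ∀ F D m {x} → 0# ≤ x → Averaged 0 F D m x
  averaged-zero F D m {x} 0≤x = linear {0#} {ι m * x} 0# (*-nonNegative (0≤ι m) 0≤x)
    (solve 1 (λ F → con 0 :* F :+ con 0 := con 0) ≈-refl F)
    (solve 3 (λ D m x → m :* x := con 0 :* D :+ m :* x :+ con 0) ≈-refl D (ι m) x)

  averaged-suc : ∀ k F D m {x x′} → Averaged k F D m x →
                 F + ι m * x ≤ D + ι m * x′ → Averaged (suc k) F D m x′
  averaged-suc k F D m {x} {x′} p q = linear (ι m * x) (+-mono-≤ p q)
    (solve 4 (λ k F m x → (con 1 :+ k) :* F :+ m :* x := k :* F :+ (F :+ m :* x))
       ≈-refl (ι k) F (ι m) x)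
    (solve 5 (λ k D m x x′ → k :* D :+ m :* x :+ (D :+ m :* x′) :=
                             (con 1 :+ k) :* D :+ m :* x′ :+ m :* x)
       ≈-refl (ι k) D (ι m) x x′)

  averaged-mono : ∀ k F m {D D′ x} → D ≤ D′ → Averaged k F D m x → Averaged k F D′ m x
  averaged-mono k F m D≤D′ p = ≤-trans p (+-mono-≤ (*-monoˡ-≤ (0≤ι k) D≤D′) ≤-refl)

  -- The number `suc k` of rounds is at least `m`, so `m x ≤ m y ≤ (k + 1) y`, and the averaged
  -- error is at most `y`.
  averaged⇒≤ : ∀ k F D m {x y} → m ≤ℕ suc k → 0# ≤ y → x ≤ y →
               Averaged (suc k) F D m x → F ≤ D + y
  averaged⇒≤ k F D m {x} {y} m≤k 0≤y x≤y p = ι-cancel k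
    (≤-trans p (≤-trans (+-mono-≤ ≤-refl (≤-trans (*-monoˡ-≤ (0≤ι m) x≤y) (*-monoʳ-≤ 0≤y (ι-mono m≤k))))
      (≤-reflexive (≈-sym (distribˡ _ D y)))))

  -- The order excludes positive characteristic: the sum is at least 1.
  ι-suc≉0 : ∀ k → ¬ ι (suc k) ≈ 0#
  ι-suc≉0 k eq = 0≉1 (antisym 0≤1 (≤-trans 1≤ι (≤-reflexive eq)))
    where
    1≤ι : 1# ≤ ι (suc k)
    1≤ι = ≤-trans (≤-reflexive (≈-sym (+-identityʳ 1#))) (+-mono-≤ ≤-refl (0≤ι k))

  -- Subtracting `ε` only lowers the left side; the rest is checked after multiplication by six.
  ⅙-bound : ∀ {ε x y} → 0# ≤ ε → 0# ≤ x → x ≤ ι 6 * y → (ι 6 ⁻¹ - ε) * x ≤ y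
  ⅙-bound {ε} {x} {y} 0≤ε 0≤x x≤6y = ≤-trans drop-ε
    (ι-cancel 5 (≤-trans (≤-reflexive 6*⅙x≈x) x≤6y))
    where
    drop-ε : (ι 6 ⁻¹ - ε) * x ≤ ι 6 ⁻¹ * x
    drop-ε = linear (ε * x) (+-mono-≤ (≤-refl {ι 6 ⁻¹ * x}) (*-nonNegative 0≤ε 0≤x))
      (≈-trans (≈-sym (distribʳ x _ ε)) (≈-trans (*-congʳ (x-y+y≈x (ι 6 ⁻¹) ε)) (≈-sym (+-identityʳ _))))
      ≈-refl
    6*⅙x≈x : ι 6 * (ι 6 ⁻¹ * x) ≈ x
    6*⅙x≈x = ≈-trans (≈-sym (*-assoc (ι 6) (ι 6 ⁻¹) x))
      (≈-trans (*-congʳ (⁻¹-inverseʳ (ι 6) (ι-suc≉0 5))) (*-identityˡ x))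

-- Exchange inequalities

∣─∣-swap : ∀ {n} (X Y : Subset n) → ∣ X ∣ ≡ ∣ Y ∣ → ∣ X ─ Y ∣ ≡ ∣ Y ─ X ∣
∣─∣-swap X Y eq = ℕ.+-cancelˡ-≡ ∣ X ∩ Y ∣ _ _ (begin
  ∣ X ∩ Y ∣ +ℕ ∣ X ─ Y ∣ ≡⟨ ∣∩∣+∣─∣ X Y ⟩
  ∣ X ∣                  ≡⟨ eq ⟩
  ∣ Y ∣                  ≡⟨ ∣∩∣+∣─∣ Y X ⟨
  ∣ Y ∩ X ∣ +ℕ ∣ Y ─ X ∣ ≡⟨ cong (λ Z → ∣ Z ∣ +ℕ ∣ Y ─ X ∣) (∩-comm Y X) ⟩
  ∣ X ∩ Y ∣ +ℕ ∣ Y ─ X ∣ ∎)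
  where
  open ≡-Reasoning

∈-─ : ∀ {n i} (X Y : Subset n) → i ∈ (X ─ Y) → i ∈ X × i ∉ Y
∈-─ {i = i} X Y p rewrite member-─ i X Y with member i X | member i Y
... | true  | false = refl , refl
... | true  | true  = contradiction p λ ()
... | false | true  = contradiction p λ ()
... | false | false = contradiction p λ ()

∈-─⁺ : ∀ {n i} (X Y : Subset n) → i ∈ X → i ∉ Y → i ∈ (X ─ Y)
∈-─⁺ {i = i} X Y p q rewrite member-─ i X Y | p | q = refl

delete-⊆ : ∀ {n} i (X : Subset n) {j} → j ∈ write false i X → j ∈ X
delete-⊆ i X {j} p with i ℕ.≟ j
... | no i≢j = trans (sym (member-write-≢ X i≢j)) p
... | yes refl =
  contradiction (trans (sym p) (member-write X (∈⇒< (write false i X) p))) λ ()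

-- Existence of maxima over families of subsets

module Maximum (ℝ : Reals) where
  open Reals ℝ renaming (refl to ≈-refl; sym to ≈-sym; trans to ≈-trans; reflexive to ≈-reflexive)
  open OrderedField ℝ

  -- Induction on `n`, splitting the family by whether the first element belongs to the set. This
  -- exhaustive search serves the proof only; the algorithm never performs it.
  maximum : ∀ {n} (f : SetFunction ℝ n) (P : Subset n → Set) → (∀ T → Dec (P T)) →
            (∀ T → ¬ P T) ⊎ ∃ (IsMaximumOver ℝ f P)
  maximum {zero} f P P? with P? []
  ... | yes p = inj₂ (f [] , ([] , p , ≈-refl) , λ { [] _ → ≤-refl })
  ... | no ¬p = inj₁ λ { [] → ¬p }
  maximum {suc n} f P P?
    with maximum (λ T → f (true ∷ T)) (λ T → P (true ∷ T)) (λ T → P? (true ∷ T))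
       | maximum (λ T → f (false ∷ T)) (λ T → P (false ∷ T)) (λ T → P? (false ∷ T))
  ... | inj₁ ¬t | inj₁ ¬f = inj₁ λ { (true ∷ T) → ¬t T ; (false ∷ T) → ¬f T }
  ... | inj₁ ¬t | inj₂ (M , (T , p , e) , max) =
    inj₂ (M , (false ∷ T , p , e) , λ { (true ∷ T) p → contradiction p (¬t T) ; (false ∷ T) → max T })
  ... | inj₂ (M , (T , p , e) , max) | inj₁ ¬f =
    inj₂ (M , (true ∷ T , p , e) , λ { (false ∷ T) p → contradiction p (¬f T) ; (true ∷ T) → max T })
  ... | inj₂ (M , (T , p , e) , max) | inj₂ (M′ , (T′ , p′ , e′) , max′) with total M M′
  ...   | inj₁ M≤M′ = inj₂ (M′ , (false ∷ T′ , p′ , e′) ,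
    λ { (true ∷ T) p → ≤-trans (max T p) M≤M′ ; (false ∷ T) → max′ T })
  ...   | inj₂ M′≤M = inj₂ (M , (true ∷ T , p , e) ,
    λ { (true ∷ T) → max T ; (false ∷ T) p → ≤-trans (max′ T p) M′≤M })

-- Inequalities for one step of a search

module Submodularity (ℝ : Reals) {n : ℕ} (f : SetFunction ℝ n)
  (f≥0 : NonNegative ℝ f) (f-submodular : Submodular ℝ f) where
  open Reals ℝ renaming (refl to ≈-refl; sym to ≈-sym; trans to ≈-trans; reflexive to ≈-reflexive)
  open OrderedField ℝ

  submodular : ∀ S T {U I} → S ∪ T ≡ U → S ∩ T ≡ I → f U + f I ≤ f S + f T
  submodular S T refl refl = f-submodular S T

  -- What a step from `X` to `X′` within `U` has to guarantee. The field `swap` says that the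
  -- marginal gains of deleting `a` and of inserting `b` sum to at most `f X′ - f X`; it does not
  -- mention the swapped set, so `X′` need not be a best swap.
  record Improves (U X X′ : Subset n) : Set where
    field
      size    : ∣ X′ ∣ ≡ ∣ X ∣
      outside : ∀ i → i ∉ U → member i X′ ≡ member i X
      ascent  : f X ≤ f X′
      swap    : ∀ a b → a ∈ U → b ∈ U → a ∈ X → b ∉ X →
                f (write true b X) + f (write false a X) ≤ f X + f X′

  -- Diminishing returns: `b` gains at least as much when added to `S` as when added to `S` together
  -- with the rest of `B`. The two sets on the right have union `S ∪ B` and intersection `S`.
  insert-marginal : ∀ S B b → b ∈ B → b ∉ S →
    f (S ∪ B) + f S ≤ f (S ∪ write false b B) + f (write true b S)
  insert-marginal S B b b∈B b∉S = submodular _ _ (member-ext union) (member-ext inter)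
    where
    union : ∀ i → i <ℕ n →
      member i ((S ∪ write false b B) ∪ write true b S) ≡ member i (S ∪ B)
    union i i<n rewrite member-∪ i (S ∪ write false b B) (write true b S)
                      | member-∪ i S (write false b B) | member-∪ i S B with b ℕ.≟ i
    ... | yes refl
      rewrite member-write {b = false} B i<n | member-write {b = true} S i<n | b∈B | b∉S = refl
    ... | no b≢i rewrite member-write-≢ {b = false} B b≢i | member-write-≢ {b = true} S b≢i
      with member i S | member i B
    ... | true  | _     = refl
    ... | false | true  = refl
    ... | false | false = refl
    inter : ∀ i → i <ℕ n →
      member i ((S ∪ write false b B) ∩ write true b S) ≡ member i S
    inter i i<n rewrite member-∩ i (S ∪ write false b B) (write true b S)
                      | member-∪ i S (write false b B) with b ℕ.≟ i
    ... | yes refl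
      rewrite member-write {b = false} B i<n | member-write {b = true} S i<n | b∉S = refl
    ... | no b≢i rewrite member-write-≢ {b = false} B b≢i | member-write-≢ {b = true} S b≢i
      with member i S | member i B
    ... | true  | _     = refl
    ... | false | true  = refl
    ... | false | false = refl

  -- Diminishing returns for deletions: `a` gains at least as much when deleted from `S` as when
  -- deleted after the rest of `A`. The two sets on the right have union `S` and intersection
  -- `S ─ A`.
  delete-marginal : ∀ S A a → a ∈ A → a ∈ S →
    f S + f (S ─ A) ≤ f (S ─ write false a A) + f (write false a S)
  delete-marginal S A a a∈A a∈S = submodular _ _ (member-ext union) (member-ext inter)
    where
    union : ∀ i → i <ℕ n →
      member i ((S ─ write false a A) ∪ write false a S) ≡ member i S
    union i i<n rewrite member-∪ i (S ─ write false a A) (write false a S)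
                      | member-─ i S (write false a A) with a ℕ.≟ i
    ... | yes refl
      rewrite member-write {b = false} A i<n | member-write {b = false} S i<n | a∈S = refl
    ... | no a≢i rewrite member-write-≢ {b = false} A a≢i | member-write-≢ {b = false} S a≢i
      with member i S | member i A
    ... | true  | true  = refl
    ... | true  | false = refl
    ... | false | _     = refl
    inter : ∀ i → i <ℕ n →
      member i ((S ─ write false a A) ∩ write false a S) ≡ member i (S ─ A)
    inter i i<n rewrite member-∩ i (S ─ write false a A) (write false a S)
                      | member-─ i S (write false a A) | member-─ i S A with a ℕ.≟ i
    ... | yes refl
      rewrite member-write {b = false} A i<n | member-write {b = false} S i<n | a∈A | a∈S = refl
    ... | no a≢i rewrite member-write-≢ {b = false} A a≢i | member-write-≢ {b = false} S a≢i
      with member i S | member i A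
    ... | true  | true  = refl
    ... | true  | false = refl
    ... | false | _     = refl

  -- Pairing the elements of A with those of B turns the exchange of A for B
  -- into ∣A∣ single swaps; by submodularity their gains dominate its gain.
  exchange : ∀ {U S S′} → Improves U S S′ → ∀ c A B → ∣ A ∣ ≡ ∣ B ∣ → ∣ A ∣ ≤ℕ c →
             (∀ i → i ∈ A → i ∈ S × i ∈ U) → (∀ i → i ∈ B → i ∉ S × i ∈ U) →
             f (S ∪ B) + f (S ─ A) + ι c * f S ≤ (f S + f S) + ι c * f S′
  exchange {U} {S} {S′} imp c A B ∣A∣≡∣B∣ ∣A∣≤c A⊆ B⊆ with ∣ A ∣ in eq
  -- Here `c` may exceed the number of swaps made; the unspent copies of `f S′ - f S` are
  -- non-negative by `ascent`.
  ... | zero = +-mono-≤ (≤-reflexive (≈-reflexive (cong₂ (λ X Y → f X + f Y) S∪B≡S S─A≡S)))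
                        (*-monoˡ-≤ (0≤ι c) (Improves.ascent imp))
    where
    S∪B≡S : S ∪ B ≡ S
    S∪B≡S = member-ext λ i _ → lemma i
      where
      lemma : ∀ i → member i (S ∪ B) ≡ member i S
      lemma i rewrite member-∪ i S B | ∣X∣≡0⇒∉ B (sym ∣A∣≡∣B∣) i with member i S
      ... | true  = refl
      ... | false = refl
    S─A≡S : S ─ A ≡ S
    S─A≡S = member-ext λ i _ → lemma i
      where
      lemma : ∀ i → member i (S ─ A) ≡ member i S
      lemma i rewrite member-─ i S A | ∣X∣≡0⇒∉ A eq i with member i S
      ... | true  = refl
      ... | false = refl
  exchange {U} {S} {S′} imp (suc c) A B ∣A∣≡∣B∣ (s≤s m≤c) A⊆ B⊆ | suc m
    with pick A eq | pick B (sym ∣A∣≡∣B∣)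
  ... | a , a∈A | b , b∈B =
    let a∈S , a∈U = A⊆ a a∈A
        b∉S , b∈U = B⊆ b b∈B
        A′ = write false a A
        B′ = write false b B
        ∣A′∣≡m = ℕ.suc-injective (trans (∣delete∣ A a∈A) eq)
        ∣B′∣≡m = ℕ.suc-injective (trans (∣delete∣ B b∈B) (sym ∣A∣≡∣B∣))
        x = f (S ∪ B′)
        y = f (S ─ A′)
        p = f (write true b S)
        q = f (write false a S)
        ih = exchange imp c A′ B′ (trans ∣A′∣≡m (sym ∣B′∣≡m))
               (subst (_≤ℕ c) (sym ∣A′∣≡m) m≤c)
               (λ i i∈A′ → A⊆ i (delete-⊆ a A i∈A′)) (λ i i∈B′ → B⊆ i (delete-⊆ b B i∈B′))
    -- The marginal inequalities replace `A`, `B` by `A′`, `B′` at the price of `p + q`, which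
    -- `swap` bounds by `f S + f S′`. This spends one of the `suc c` copies of `f S′ - f S`.
    in linear (p + q + x + y + f S)
         (+-mono-≤ (+-mono-≤ (insert-marginal S B b b∈B b∉S) (delete-marginal S A a a∈A a∈S))
                   (+-mono-≤ (Improves.swap imp a b a∈U b∈U a∈S b∉S) ih))
         (solve 8 (λ u v s k p q x y →
            u :+ v :+ (con 1 :+ k) :* s :+ (p :+ q :+ x :+ y :+ s) :=
            ((u :+ s) :+ (s :+ v)) :+ ((p :+ q) :+ (x :+ y :+ k :* s)))
            ≈-refl (f (S ∪ B)) (f (S ─ A)) (f S) (ι c) p q x y)
         (solve 7 (λ s s′ k p q x y →
            ((x :+ p) :+ (y :+ q)) :+ ((s :+ s′) :+ (s :+ s :+ k :* s′)) :=
            s :+ s :+ (con 1 :+ k) :* s′ :+ (p :+ q :+ x :+ y :+ s))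
            ≈-refl (f S) (f S′) (ι c) p q x y)

  -- Non-negativity of `f` enters the exchange argument here: values of by-product sets are
  -- discarded.
  f-drop : ∀ S {x y} → f S + x ≤ y → x ≤ y
  f-drop S {x} {y} p = linear (f S) (+-mono-≤ p (f≥0 S))
    (≈-trans (+-comm x (f S)) (≈-sym (+-identityʳ _))) ≈-refl

  private
    ∣X─Y∣≤∣X∣ : ∀ (X Y : Subset n) → ∣ X ─ Y ∣ ≤ℕ ∣ X ∣
    ∣X─Y∣≤∣X∣ X Y = ∣∣-mono (X ─ Y) X λ i i∈ → proj₁ (∈-─ X Y i∈)

  -- Exchanging `S ─ C` for `C ─ S` leads to `S ∪ C` on the insertion side and to `S ∩ C` on the
  -- deletion side.
  improvement-all : ∀ {U S S′} → (∀ i → i <ℕ n → i ∈ U) → Improves U S S′ →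
    ∀ C c → ∣ S ∣ ≡ c → ∣ C ∣ ≡ c →
    f (S ∪ C) + f (S ∩ C) + ι c * f S ≤ (f S + f S) + ι c * f S′
  improvement-all {U} {S} {S′} full imp C c ∣S∣≡c ∣C∣≡c =
    subst₂ (λ P Q → f P + f Q + ι c * f S ≤ (f S + f S) + ι c * f S′)
      (member-ext λ i _ → union i) (member-ext λ i _ → inter i)
      (exchange imp c (S ─ C) (C ─ S) (∣─∣-swap S C (trans ∣S∣≡c (sym ∣C∣≡c)))
        (ℕ.≤-trans (∣X─Y∣≤∣X∣ S C) (ℕ.≤-reflexive ∣S∣≡c))
        (λ i i∈ → proj₁ (∈-─ S C i∈) , full i (∈⇒< (S ─ C) i∈))
        (λ i i∈ → proj₂ (∈-─ C S i∈) , full i (∈⇒< (C ─ S) i∈)))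
    where
    union : ∀ i → member i (S ∪ (C ─ S)) ≡ member i (S ∪ C)
    union i rewrite member-∪ i S (C ─ S) | member-─ i C S | member-∪ i S C
      with member i S | member i C
    ... | true  | _     = refl
    ... | false | true  = refl
    ... | false | false = refl
    inter : ∀ i → member i (S ─ (S ─ C)) ≡ member i (S ∩ C)
    inter i rewrite member-─ i S (S ─ C) | member-─ i S C | member-∩ i S C
      with member i S | member i C
    ... | true  | true  = refl
    ... | true  | false = refl
    ... | false | _     = refl

  -- X is disjoint from R (σ = true) or contains its complement (σ = false),
  -- and swaps within U keep it so.
  record Opposite (σ : Bool) (R U X : Subset n) : Set where
    field
      pinned : ∀ i → i <ℕ n → member i R ≡ σ → i ∉ U × member i X ≡ not σ
      free   : ∀ i → i <ℕ n → member i R ≡ not σ → i ∈ U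

  opposite-step : ∀ {σ R U X X′} → Opposite σ R U X → Improves U X X′ → Opposite σ R U X′
  opposite-step opp imp = record
    { pinned = λ i i<n Ri → let i∉U , Xi = Opposite.pinned opp i i<n Ri in
                 i∉U , trans (Improves.outside imp i i∉U) Xi
    ; free   = Opposite.free opp
    }

  -- After an exchange, submodularity against `R ∪ C` and `R ∩ C` reassembles `C`. For `σ = true`,
  -- `X ∪ B` meets `R ∪ C` in `C ─ R`, whose union with `R ∩ C` is `C`. For `σ = false`, the union
  -- of `R ∩ C` and `X ─ A` meets `R ∪ C` exactly in `C`. All other sets that arise are dropped.
  improvement-opposite : ∀ σ {R U X X′} → Opposite σ R U X → Improves U X X′ →
    ∀ C c → ∣ X ∣ ≡ c → ∣ C ∣ ≡ c →
    f C + ι c * f X ≤ (f (R ∪ C) + f (R ∩ C)) + (f X + f X) + ι c * f X′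
  improvement-opposite true {R} {U} {X} {X′} opp imp C c ∣X∣≡c ∣C∣≡c =
    linear (f (X ∪ B) + f (C ─ R))
      (+-mono-≤ (+-mono-≤ (f-drop _ (submodular (R ∪ C) (X ∪ B) refl (member-ext inter)))
                          (f-drop _ (≤-trans (≤-reflexive (+-comm _ _))
                            (submodular (C ─ R) (R ∩ C) (member-ext λ i _ → union i) refl))))
                (f-drop (X ─ A) (≤-trans (≤-reflexive (≈-trans (≈-sym (+-assoc _ _ _)) (+-congʳ (+-comm _ _))))
                  (exchange imp c A B ∣A∣≡∣B∣ ∣A∣≤c A⊆ B⊆))))
      (solve 4 (λ u k x r → u :+ k :+ (x :+ r) := r :+ u :+ (x :+ k))
         ≈-refl (f C) (ι c * f X) (f (X ∪ B)) (f (C ─ R)))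
      (solve 6 (λ p q s k x r → (p :+ x) :+ (r :+ q) :+ (s :+ s :+ k) :=
                                p :+ q :+ (s :+ s) :+ k :+ (x :+ r))
         ≈-refl (f (R ∪ C)) (f (R ∩ C)) (f X) (ι c * f X′) (f (X ∪ B)) (f (C ─ R)))
    where
    -- `B` is what `X` lacks of `C ─ R`. For balance, `A` is any set of the same size inside
    -- `X ─ C`, which is as large as `C ─ X` and hence large enough.
    B = (C ─ R) ─ X
    B⊆C─X : ∀ i → i ∈ B → i ∈ (C ─ X)
    B⊆C─X i i∈B = let i∈C─R , i∉X = ∈-─ (C ─ R) X i∈B in
      ∈-─⁺ C X (proj₁ (∈-─ C R i∈C─R)) i∉X
    choice = subset-of-size ∣ B ∣ (X ─ C) (ℕ.≤-trans (∣∣-mono B (C ─ X) B⊆C─X)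
      (ℕ.≤-reflexive (∣─∣-swap C X (trans ∣C∣≡c (sym ∣X∣≡c)))))
    A = proj₁ choice
    ∣A∣≡∣B∣ = proj₁ (proj₂ choice)
    A⊆X : ∀ i → i ∈ A → i ∈ X
    A⊆X i i∈A = proj₁ (∈-─ X C (proj₂ (proj₂ choice) i i∈A))
    ∣A∣≤c : ∣ A ∣ ≤ℕ c
    ∣A∣≤c = ℕ.≤-trans (∣∣-mono A X A⊆X) (ℕ.≤-reflexive ∣X∣≡c)
    X∩R≡∅ : ∀ i → i ∈ X → i ∉ R
    X∩R≡∅ i i∈X with member i R in eq
    ... | false = refl
    ... | true  = contradiction (trans (sym i∈X) (proj₂ (Opposite.pinned opp i (∈⇒< X i∈X) eq))) λ ()
    A⊆ : ∀ i → i ∈ A → i ∈ X × i ∈ U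
    A⊆ i i∈A = A⊆X i i∈A , Opposite.free opp i (∈⇒< A i∈A) (X∩R≡∅ i (A⊆X i i∈A))
    B⊆ : ∀ i → i ∈ B → i ∉ X × i ∈ U
    B⊆ i i∈B = let i∈C─R , i∉X = ∈-─ (C ─ R) X i∈B in
      i∉X , Opposite.free opp i (∈⇒< B i∈B) (proj₂ (∈-─ C R i∈C─R))
    inter : ∀ i → i <ℕ n → member i ((R ∪ C) ∩ (X ∪ B)) ≡ member i (C ─ R)
    inter i _ rewrite member-∩ i (R ∪ C) (X ∪ B) | member-∪ i R C | member-∪ i X B
                    | member-─ i (C ─ R) X | member-─ i C R
      with member i X | member i R | X∩R≡∅ i | member i C
    ... | true  | true  | Ri | _     = contradiction (Ri refl) λ ()
    ... | true  | false | _  | true  = refl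
    ... | true  | false | _  | false = refl
    ... | false | true  | _  | true  = refl
    ... | false | true  | _  | false = refl
    ... | false | false | _  | true  = refl
    ... | false | false | _  | false = refl
    union : ∀ i → member i ((C ─ R) ∪ (R ∩ C)) ≡ member i C
    union i rewrite member-∪ i (C ─ R) (R ∩ C) | member-─ i C R | member-∩ i R C
      with member i R | member i C
    ... | true  | true  = refl
    ... | true  | false = refl
    ... | false | true  = refl
    ... | false | false = refl
  improvement-opposite false {R} {U} {X} {X′} opp imp C c ∣X∣≡c ∣C∣≡c =
    linear (f (X ─ A) + f ((R ∩ C) ∪ (X ─ A)))
      (+-mono-≤ (+-mono-≤ (f-drop _ (≤-trans (≤-reflexive (+-comm _ _))
                            (submodular (R ∩ C) (X ─ A) refl refl)))
                          (f-drop _ (submodular (R ∪ C) ((R ∩ C) ∪ (X ─ A)) refl (member-ext inter))))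
                (f-drop (X ∪ B) (≤-trans (≤-reflexive (≈-sym (+-assoc _ _ _)))
                  (exchange imp c A B ∣A∣≡∣B∣ ∣A∣≤c A⊆ B⊆))))
      (solve 4 (λ u k x r → u :+ k :+ (x :+ r) := r :+ u :+ (x :+ k))
         ≈-refl (f C) (ι c * f X) (f (X ─ A)) (f ((R ∩ C) ∪ (X ─ A))))
      (solve 6 (λ p q s k x r → (q :+ x) :+ (p :+ r) :+ (s :+ s :+ k) :=
                                p :+ q :+ (s :+ s) :+ k :+ (x :+ r))
         ≈-refl (f (R ∪ C)) (f (R ∩ C)) (f X) (ι c * f X′) (f (X ─ A)) (f ((R ∩ C) ∪ (X ─ A))))
    where
    -- Without `A`, every remaining element of `X` lies in `C` or outside `R`. For balance, `B` is
    -- any set of the same size inside `C ─ X`.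
    A = (X ─ C) ∩ R
    A⊆X─C : ∀ i → i ∈ A → i ∈ (X ─ C)
    A⊆X─C i i∈A rewrite member-∩ i (X ─ C) R with member i (X ─ C)
    ... | true = refl
    A⊆R : ∀ i → i ∈ A → i ∈ R
    A⊆R i i∈A rewrite member-∩ i (X ─ C) R with member i (X ─ C)
    ... | true = i∈A
    A⊆X : ∀ i → i ∈ A → i ∈ X
    A⊆X i i∈A = proj₁ (∈-─ X C (A⊆X─C i i∈A))
    choice = subset-of-size ∣ A ∣ (C ─ X) (ℕ.≤-trans (∣∣-mono A (X ─ C) A⊆X─C)
      (ℕ.≤-reflexive (∣─∣-swap X C (trans ∣X∣≡c (sym ∣C∣≡c)))))
    B = proj₁ choice
    ∣A∣≡∣B∣ = sym (proj₁ (proj₂ choice))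
    ∣A∣≤c : ∣ A ∣ ≤ℕ c
    ∣A∣≤c = ℕ.≤-trans (∣∣-mono A X A⊆X) (ℕ.≤-reflexive ∣X∣≡c)
    R∪X≡V : ∀ i → i <ℕ n → i ∉ X → i ∈ R
    R∪X≡V i i<n i∉X with member i R in eq
    ... | true  = refl
    ... | false = contradiction (trans (sym i∉X) (proj₂ (Opposite.pinned opp i i<n eq))) λ ()
    A⊆ : ∀ i → i ∈ A → i ∈ X × i ∈ U
    A⊆ i i∈A = A⊆X i i∈A , Opposite.free opp i (∈⇒< A i∈A) (A⊆R i i∈A)
    B⊆ : ∀ i → i ∈ B → i ∉ X × i ∈ U
    B⊆ i i∈B = let i∉X = proj₂ (∈-─ C X (proj₂ (proj₂ choice) i i∈B)) in
      i∉X , Opposite.free opp i (∈⇒< B i∈B) (R∪X≡V i (∈⇒< B i∈B) i∉X)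
    inter : ∀ i → i <ℕ n → member i ((R ∪ C) ∩ ((R ∩ C) ∪ (X ─ A))) ≡ member i C
    inter i i<n rewrite member-∩ i (R ∪ C) ((R ∩ C) ∪ (X ─ A)) | member-∪ i R C
                      | member-∪ i (R ∩ C) (X ─ A) | member-∩ i R C | member-─ i X A
                      | member-∩ i (X ─ C) R | member-─ i X C
      with member i X | member i R | R∪X≡V i i<n | member i C
    ... | true  | true  | _  | true  = refl
    ... | true  | true  | _  | false = refl
    ... | true  | false | _  | true  = refl
    ... | true  | false | _  | false = refl
    ... | false | true  | _  | true  = refl
    ... | false | true  | _  | false = refl
    ... | false | false | Ri | _     = contradiction (Ri refl) λ ()

-- Hoare logic with running times

-- Bounds the running time under the assumption that every loop makes at most
-- N iterations.
time : ℕ → Program → ℕ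
time N skip                    = 0
time N (exec i)                = 1
time N (p ⨾ q)                 = time N p +ℕ time N q
time N (if b then p else q)    = suc (time N p +ℕ time N q)
time N (while b repeat p)      = suc (N *ℕ suc (time N p))

-- Coefficient and exponent of a polynomial bound on `time`. Exponents of composed programs are
-- added, which is crude but bounds either one. A loop adds 2 to `length`: its final test and the
-- test before each iteration.
length nesting : Program → ℕ
length skip                   = 0
length (exec i)               = 1
length (p ⨾ q)                = length p +ℕ length q
length (if b then p else q)   = suc (length p +ℕ length q)
length (while b repeat p)     = suc (suc (length p))
nesting skip                  = 0
nesting (exec i)              = 0
nesting (p ⨾ q)               = nesting p +ℕ nesting q
nesting (if b then p else q)  = nesting p +ℕ nesting q
nesting (while b repeat p)    = suc (nesting p)

private
  -- Both exponents may be raised to `d + e`, because `suc n` is at least 1.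
  poly-+ : ∀ {t u} j k n d e → t ≤ℕ j *ℕ suc n ^ d → u ≤ℕ k *ℕ suc n ^ e →
           t +ℕ u ≤ℕ (j +ℕ k) *ℕ suc n ^ (d +ℕ e)
  poly-+ {t} {u} j k n d e t≤ u≤ = begin
    t +ℕ u                                          ≤⟨ ℕ.+-mono-≤ t≤ u≤ ⟩
    j *ℕ suc n ^ d +ℕ k *ℕ suc n ^ e                 ≤⟨ ℕ.+-mono-≤
      (ℕ.*-monoʳ-≤ j (ℕ.^-monoʳ-≤ (suc n) (ℕ.m≤m+n d e)))
      (ℕ.*-monoʳ-≤ k (ℕ.^-monoʳ-≤ (suc n) (ℕ.m≤n+m e d))) ⟩
    j *ℕ suc n ^ (d +ℕ e) +ℕ k *ℕ suc n ^ (d +ℕ e)   ≡⟨ ℕ.*-distribʳ-+ (suc n ^ (d +ℕ e)) j k ⟨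
    (j +ℕ k) *ℕ suc n ^ (d +ℕ e)                    ∎
    where open ℕ.≤-Reasoning

time-polynomial : ∀ n p → time (suc n) p ≤ℕ length p *ℕ suc n ^ nesting p
time-polynomial n skip     = z≤n
time-polynomial n (exec i) = s≤s z≤n
time-polynomial n (p ⨾ q)  =
  poly-+ (length p) (length q) n (nesting p) (nesting q) (time-polynomial n p) (time-polynomial n q)
time-polynomial n (if b then p else q) =
  poly-+ 1 (length p +ℕ length q) n 0 (nesting p +ℕ nesting q) (s≤s z≤n)
    (poly-+ (length p) (length q) n (nesting p) (nesting q) (time-polynomial n p) (time-polynomial n q))
time-polynomial n (while b repeat p) =
  poly-+ 1 (suc (length p)) n 0 (suc (nesting p)) (s≤s z≤n) (begin
    suc n *ℕ suc (time (suc n) p)                        ≤⟨ ℕ.*-monoʳ-≤ (suc n)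
      (poly-+ 1 (length p) n 0 (nesting p) (s≤s z≤n) (time-polynomial n p)) ⟩
    suc n *ℕ (suc (length p) *ℕ suc n ^ nesting p)            ≡⟨ ℕ.*-assoc (suc n) (suc (length p)) _ ⟨
    suc n *ℕ suc (length p) *ℕ suc n ^ nesting p              ≡⟨ cong (_*ℕ suc n ^ nesting p)
      (ℕ.*-comm (suc n) (suc (length p))) ⟩
    suc (length p) *ℕ suc n *ℕ suc n ^ nesting p              ≡⟨ ℕ.*-assoc (suc (length p)) (suc n) _ ⟩
    suc (length p) *ℕ suc n ^ suc (nesting p)                ∎)
  where open ℕ.≤-Reasoning

-- Boolean-valued, so that frame conditions of concrete programs hold by `refl`.
every : (Instruction → Bool) → Program → Bool
every safe skip                  = true
every safe (exec i)              = safe i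
every safe (p ⨾ q)               = every safe p ∧ every safe q
every safe (if b then p else q)  = every safe p ∧ every safe q
every safe (while b repeat p)    = every safe p

-- An indirect reference may point anywhere, so it counts as a possible write to every register.
avoids : ℕ → Ref → Bool
avoids a (cell b) = not (b ≡ᵇ a)
avoids a (at b)   = false

keepsNat keepsSet : ℕ → Instruction → Bool
keepsNat a (const r _) = avoids a r
keepsNat a (copy r _)  = avoids a r
keepsNat a (add r _ _) = avoids a r
keepsNat a (sub r _ _) = avoids a r
keepsNat a _           = true
keepsSet a (insert X _) = avoids a X
keepsSet a (delete X _) = avoids a X
keepsSet a _            = true

module _ {A : Set} where
  update-same : ∀ (m : ℕ → A) a {v} → update m a v a ≡ v
  update-same m a rewrite Equivalence.to T-≡ (ℕ.≡⇒≡ᵇ a a refl) = refl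

  update-other : ∀ (m : ℕ → A) a b {v} → (a ≡ᵇ b) ≡ false → update m a v b ≡ m b
  update-other m a b eq rewrite eq = refl

∧-true : ∀ {x y} → x ∧ y ≡ true → x ≡ true × y ≡ true
∧-true {true} {true} refl = refl , refl

not-true : ∀ {x} → not x ≡ true → x ≡ false
not-true {false} refl = refl

≤⇒≤ᵇ≡true : ∀ {i j} → i ≤ℕ j → (i ≤ᵇ j) ≡ true
≤⇒≤ᵇ≡true i≤j = Equivalence.to T-≡ (ℕ.≤⇒≤ᵇ i≤j)

≤ᵇ≡true⇒≤ : ∀ {i j} → (i ≤ᵇ j) ≡ true → i ≤ℕ j
≤ᵇ≡true⇒≤ {i} {j} eq = ℕ.≤ᵇ⇒≤ i j (Equivalence.from T-≡ eq)

≤ᵇ≡false⇒> : ∀ {i j} → (i ≤ᵇ j) ≡ false → j <ℕ i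
≤ᵇ≡false⇒> eq = ℕ.≰⇒> λ i≤j → contradiction (trans (sym eq) (≤⇒≤ᵇ≡true i≤j)) λ ()

>⇒≤ᵇ≡false : ∀ {i j} → j <ℕ i → (i ≤ᵇ j) ≡ false
>⇒≤ᵇ≡false {i} {j} j<i with i ≤ᵇ j in eq
... | false = refl
... | true  = contradiction (≤ᵇ≡true⇒≤ eq) (ℕ.<⇒≱ j<i)

-- Element loops also visit the index n, which denotes no element of V.
for : ℕ → Program → Program
for i p = exec (const (cell i) 0) ⨾ while leq (cell i) (cell 0) repeat
  (p ⨾ exec (const (cell 3) 1) ⨾ exec (add (cell i) (cell i) (cell 3)))

module Hoare (ℝ : Reals) {n : ℕ} (f : SetFunction ℝ n) where
  open Machine ℝ f

  -- Total correctness with the running time built in; `suc n` is the number of iterations of every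
  -- `for` loop.
  Runs : Program → State → (State → Set) → Set
  Runs p s Q = ∃ λ s′ → ∃ λ t → ⟨ p , s ⟩⇓ s′ [ t ] × t ≤ℕ time (suc n) p × Q s′

  private variable
    p q : Program
    s : State
    Q R : State → Set

  run-map : (∀ {s} → Q s → R s) → Runs p s Q → Runs p s R
  run-map g (s′ , t , run , t≤ , q) = s′ , t , run , t≤ , g q

  run-skip : Q s → Runs skip s Q
  run-skip q = _ , _ , skip , z≤n , q

  run-exec : ∀ {i} → Q (step i s) → Runs (exec i) s Q
  run-exec q = _ , _ , exec , s≤s z≤n , q

  run-seq : Runs p s (λ s′ → Runs q s′ Q) → Runs (p ⨾ q) s Q
  run-seq (_ , _ , run , t≤ , _ , _ , run′ , u≤ , q) =
    _ , _ , seq run run′ , ℕ.+-mono-≤ t≤ u≤ , q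

  run-if : ∀ {b} → (test b s ≡ true → Runs p s Q) → (test b s ≡ false → Runs q s Q) →
           Runs (if b then p else q) s Q
  run-if {s = s} {p = p} {q = q} {b = b} then″ else″ with test b s in eq
  ... | true  = let _ , _ , run , t≤ , q = then″ refl in
    _ , _ , then′ eq run , s≤s (ℕ.≤-trans t≤ (ℕ.m≤m+n _ _)) , q
  ... | false = let _ , _ , run , t≤ , q = else″ refl in
    _ , _ , else′ eq run , s≤s (ℕ.≤-trans t≤ (ℕ.m≤n+m _ (time (suc n) p))) , q

  preserved : ∀ {A : Set} (g : State → A) (safe : Instruction → Bool) →
              (∀ i s → safe i ≡ true → g (step i s) ≡ g s) →
              ∀ {p s s′ t} → ⟨ p , s ⟩⇓ s′ [ t ] → every safe p ≡ true → g s′ ≡ g s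
  preserved g safe keep skip            ok = refl
  preserved g safe keep exec            ok = keep _ _ ok
  preserved g safe keep (seq r r′)      ok = let o , o′ = ∧-true ok in
    trans (preserved g safe keep r′ o′) (preserved g safe keep r o)
  preserved g safe keep (then′ _ r)     ok = preserved g safe keep r (proj₁ (∧-true ok))
  preserved g safe keep (else′ {p = p} _ r) ok =
    preserved g safe keep r (proj₂ (∧-true {every safe p} ok))
  preserved g safe keep (stop _)        ok = refl
  preserved g safe keep (loop _ r r′)   ok =
    trans (preserved g safe keep r′ ok) (preserved g safe keep r ok)

  keepsNat-step : ∀ a i s → keepsNat a i ≡ true → nat (step i s) a ≡ nat s a
  keepsNat-step a (const (cell b) _) s ok = update-other (nat s) b a (not-true ok)
  keepsNat-step a (copy (cell b) _)  s ok = update-other (nat s) b a (not-true ok)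
  keepsNat-step a (add (cell b) _ _) s ok = update-other (nat s) b a (not-true ok)
  keepsNat-step a (sub (cell b) _ _) s ok = update-other (nat s) b a (not-true ok)
  keepsNat-step a (constʳ0 _)  s ok = refl
  keepsNat-step a (copyʳ _ _)  s ok = refl
  keepsNat-step a (addʳ _ _ _) s ok = refl
  keepsNat-step a (subʳ _ _ _) s ok = refl
  keepsNat-step a (insert _ _) s ok = refl
  keepsNat-step a (delete _ _) s ok = refl
  keepsNat-step a (query _ _)  s ok = refl

  keepsSet-step : ∀ a i s → keepsSet a i ≡ true → set (step i s) a ≡ set s a
  keepsSet-step a (insert (cell b) _) s ok = update-other (set s) b a (not-true ok)
  keepsSet-step a (delete (cell b) _) s ok = update-other (set s) b a (not-true ok)
  keepsSet-step a (const _ _)  s ok = refl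
  keepsSet-step a (copy _ _)   s ok = refl
  keepsSet-step a (add _ _ _)  s ok = refl
  keepsSet-step a (sub _ _ _)  s ok = refl
  keepsSet-step a (constʳ0 _)  s ok = refl
  keepsSet-step a (copyʳ _ _)  s ok = refl
  keepsSet-step a (addʳ _ _ _) s ok = refl
  keepsSet-step a (subʳ _ _ _) s ok = refl
  keepsSet-step a (query _ _)  s ok = refl

  record Frame (p : Program) (s s′ : State) : Set where
    field
      keep-nat : ∀ a → every (keepsNat a) p ≡ true → nat s′ a ≡ nat s a
      keep-set : ∀ a → every (keepsSet a) p ≡ true → set s′ a ≡ set s a
  open Frame public

  run-frame : Runs p s Q → Runs p s (λ s′ → Q s′ × Frame p s s′)
  run-frame (s′ , t , run , t≤ , q) = s′ , t , run , t≤ , q , record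
    { keep-nat = λ a → preserved (λ s → nat s a) (keepsNat a) (keepsNat-step a) run
    ; keep-set = λ a → preserved (λ s → set s a) (keepsSet a) (keepsSet-step a) run
    }

  tick : ℕ → State → State
  tick i s = step (add (cell i) (cell i) (cell 3)) (step (const (cell 3) 1) s)

  -- The invariant is re-established at `tick i s′`, after the increment that ends an iteration, so
  -- it has to survive the overwriting of cell 3 and of the counter.
  run-for : (Inv : ℕ → State → Set) → ∀ {i} →
    (i ≡ᵇ 0) ≡ false → (3 ≡ᵇ i) ≡ false →
    every (keepsNat i) p ≡ true → every (keepsNat 0) p ≡ true →
    nat s 0 ≡ n → Inv 0 (step (const (cell i) 0) s) →
    (∀ k s → k ≤ℕ n → nat s 0 ≡ n → nat s i ≡ k → Inv k s → Runs p s (λ s′ → Inv (suc k) (tick i s′))) →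
    Runs (for i p) s (λ s′ → nat s′ 0 ≡ n × Inv (suc n) s′)
  run-for {p = p} {s = s} Inv {i} i≢0 3≢i ki k0 ≡n inv₀ body =
    run-seq (run-exec (go (suc n) 0 _ (ℕ.+-identityʳ _)
      (trans (update-other (nat s) i 0 i≢0) ≡n) (update-same (nat s) i) inv₀))
    where
    Body = p ⨾ exec (const (cell 3) 1) ⨾ exec (add (cell i) (cell i) (cell 3))
    Loop = while leq (cell i) (cell 0) repeat Body
    -- `r` counts the iterations still to come; it makes the recursion structural and yields the
    -- time bound.
    go : ∀ r k s → r +ℕ k ≡ suc n → nat s 0 ≡ n → nat s i ≡ k → Inv k s →
         ∃ λ s′ → ∃ λ t → ⟨ Loop , s ⟩⇓ s′ [ t ] × t ≤ℕ suc (r *ℕ suc (time (suc n) Body)) ×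
         nat s′ 0 ≡ n × Inv (suc n) s′
    go zero k s refl s0 si inv = s , 1 , stop (trans (cong₂ _≤ᵇ_ si s0) (>⇒≤ᵇ≡false (ℕ.≤-refl {suc n}))) ,
      s≤s z≤n , s0 , inv
    go (suc r) k s eq s0 si inv
      with k≤n ← ℕ.≤-trans (ℕ.m≤n+m k r) (ℕ.≤-reflexive (ℕ.suc-injective eq))
      with s₁ , t , run , t≤ , inv₁ , frame ← run-frame (body k s k≤n s0 si inv)
      with s₂ , u , run₂ , u≤ , post ← go r (suc k) (tick i s₁) (trans (ℕ.+-suc r k) eq)
             (trans (update-other (update (nat s₁) 3 1) i 0 i≢0) (trans (keep-nat frame 0 k0) s0))
             (trans (update-same (update (nat s₁) 3 1) i)
               (trans (cong (_+ℕ 1) (trans (update-other (nat s₁) 3 i 3≢i) (trans (keep-nat frame i ki) si)))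
                      (ℕ.+-comm k 1)))
             inv₁
      = s₂ , _ , loop (trans (cong₂ _≤ᵇ_ si s0) (≤⇒≤ᵇ≡true k≤n)) (seq run (seq exec exec)) run₂ ,
        s≤s (begin
          (t +ℕ 2) +ℕ u                                                     ≤⟨ ℕ.+-mono-≤ (ℕ.+-monoˡ-≤ 2 t≤) u≤ ⟩
          time (suc n) Body +ℕ suc (r *ℕ suc (time (suc n) Body))           ≡⟨ ℕ.+-suc _ _ ⟩
          suc r *ℕ suc (time (suc n) Body)                                  ∎) , post
      where open ℕ.≤-Reasoning

-- The algorithm

-- Set registers: 0 the best set found, 1 the set S₁ of the first search, 2 the
-- current set X, 3 the set U of elements that may be exchanged.  Number
-- registers: 0 and 1 hold n and c, 2 an element, 3 the constant 1, 4 and 5 the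
-- best deletion and insertion (n if there is none), 6 the size of X, 7 and 8
-- count rounds.  Real registers: 1 and 2 hold the values after the best
-- deletion and insertion.

put : Bool → ℕ → Instruction
put true  y = insert (cell y) (cell 2)
put false y = delete (cell y) (cell 2)

-- One loop for three uses: `true false` copies, `false true` complements, and `true true` produces
-- all of `V`.
assign : Bool → Bool → ℕ → ℕ → Program
assign b₁ b₂ x y = for 2 (if mem (cell 2) (cell x) then exec (put b₁ y) else exec (put b₂ y))

fill trim : Program
fill = for 2 (if leq (cell 1) (cell 6) then skip else
  if mem (cell 2) (cell 2) then skip else
  (exec (insert (cell 2) (cell 2)) ⨾ exec (const (cell 3) 1) ⨾ exec (add (cell 6) (cell 6) (cell 3))))
trim = for 2 (if leq (cell 6) (cell 1) then skip else
  if mem (cell 2) (cell 2) then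
  (exec (delete (cell 2) (cell 2)) ⨾ exec (const (cell 3) 1) ⨾ exec (sub (cell 6) (cell 6) (cell 3)))
  else skip)

-- Trial changes are made to `X` itself and undone right after the query. The records start at the
-- value 0 with index `n`, so the first candidate always replaces them. A swap is made only if the
-- two recorded values sum to more than `2 f X`.
scan-element scan swap-best advance : Program
scan-element = if mem (cell 2) (cell 3)
  then if mem (cell 2) (cell 2)
    then (exec (delete (cell 2) (cell 2)) ⨾ exec (query (cell 0) (cell 2)) ⨾ exec (insert (cell 2) (cell 2)) ⨾
      if leqʳ (cell 1) (cell 0)
        then exec (copyʳ (cell 1) (cell 0)) ⨾ exec (copy (cell 4) (cell 2))
        else skip)
    else (exec (insert (cell 2) (cell 2)) ⨾ exec (query (cell 0) (cell 2)) ⨾ exec (delete (cell 2) (cell 2)) ⨾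
      if leqʳ (cell 2) (cell 0)
        then exec (copyʳ (cell 2) (cell 0)) ⨾ exec (copy (cell 5) (cell 2))
        else skip)
  else skip
scan = exec (constʳ0 (cell 1)) ⨾ exec (constʳ0 (cell 2)) ⨾
  exec (copy (cell 4) (cell 0)) ⨾ exec (copy (cell 5) (cell 0)) ⨾ for 2 scan-element
swap-best = exec (query (cell 0) (cell 2)) ⨾
  exec (addʳ (cell 0) (cell 0) (cell 0)) ⨾ exec (addʳ (cell 1) (cell 1) (cell 2)) ⨾
  if leqʳ (cell 1) (cell 0) then skip else
  if leq (cell 0) (cell 4) then skip else
  if leq (cell 0) (cell 5) then skip else
  (exec (delete (cell 2) (cell 4)) ⨾ exec (insert (cell 2) (cell 5)))
advance = scan ⨾ swap-best ⨾
  exec (query (cell 0) (cell 2)) ⨾ exec (query (cell 1) (cell 0)) ⨾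
  if leqʳ (cell 0) (cell 1) then skip else assign true false 2 0

-- The second search starts from `∁ S₁`, of size `n - c`. If this is at most `c`, the set is
-- enlarged and swaps are confined to `S₁`; otherwise it is shrunk and swaps are confined to `∁ S₁`.
restart : Program
restart = assign false true 1 2 ⨾ exec (sub (cell 6) (cell 0) (cell 1)) ⨾
  if leq (cell 6) (cell 1)
  then (assign true false 1 3 ⨾ fill)
  else (assign false true 1 3 ⨾ trim)

-- In each outer round the second search precedes the advance of `S₁`, so that both inequalities to
-- be combined concern the same `S₁`.
algorithm : Program
algorithm = fill ⨾ assign true false 2 0 ⨾ assign true false 2 1 ⨾
  for 8 (restart ⨾ for 7 advance ⨾
         assign true false 1 2 ⨾ assign true true 1 3 ⨾
         advance ⨾ assign true false 2 1)

-- Running maxima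

module Best (ℝ : Reals) where
  open Reals ℝ renaming (refl to ≈-refl; sym to ≈-sym; trans to ≈-trans; reflexive to ≈-reflexive)
  open OrderedField ℝ

  -- Loop invariant of a search for the maximum of `φ` over the candidates in `V` below `k`. The
  -- sentinel `N` comes with the value 0, a lower bound for every non-negative `φ`.
  data Best (N : ℕ) (V : ℕ → Set) (φ : ℕ → Carrier) (k : ℕ) (a : ℕ) (x : Carrier) : Set where
    none : a ≡ N → x ≡ 0# → (∀ i → i <ℕ k → ¬ V i) → Best N V φ k a x
    some : V a → x ≡ φ a → (∀ i → i <ℕ k → V i → φ i ≤ x) → Best N V φ k a x

  module _ {N : ℕ} {V : ℕ → Set} {φ : ℕ → Carrier} {k a : ℕ} {x : Carrier} where
    best-skip : ¬ V k → Best N V φ k a x → Best N V φ (suc k) a x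
    best-skip ¬Vk (none a≡ x≡ empty) = none a≡ x≡ λ i i< → case i (ℕ.m<1+n⇒m<n∨m≡n i<)
      where
      case : ∀ i → i <ℕ k ⊎ i ≡ k → ¬ V i
      case i (inj₁ i<k)  = empty i i<k
      case i (inj₂ refl) = ¬Vk
    best-skip ¬Vk (some Va x≡ max) = some Va x≡ λ i i< → case i (ℕ.m<1+n⇒m<n∨m≡n i<)
      where
      case : ∀ i → i <ℕ k ⊎ i ≡ k → V i → φ i ≤ x
      case i (inj₁ i<k)  Vi = max i i<k Vi
      case i (inj₂ refl) Vk = contradiction Vk ¬Vk

    best-take : V k → x ≤ φ k → Best N V φ k a x → Best N V φ (suc k) k (φ k)
    best-take Vk x≤ best = some Vk refl λ i i< → case i (ℕ.m<1+n⇒m<n∨m≡n i<) best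
      where
      case : ∀ i → i <ℕ k ⊎ i ≡ k → Best N V φ k a x → V i → φ i ≤ φ k
      case i (inj₁ i<k)  (none _ _ empty) Vi = contradiction Vi (empty i i<k)
      case i (inj₁ i<k)  (some _ _ max)   Vi = ≤-trans (max i i<k Vi) x≤
      case i (inj₂ refl) _                Vi = ≤-refl

    best-keep : 0# ≤ φ k → ¬ x ≤ φ k → Best N V φ k a x → Best N V φ (suc k) a x
    -- Without an earlier candidate `x` is 0, so the comparison cannot have failed.
    best-keep 0≤ x≰ (none a≡ x≡ empty) = contradiction (≤-trans (≤-reflexive (≈-reflexive x≡)) 0≤) x≰
    best-keep 0≤ x≰ (some Va x≡ max)   = some Va x≡ λ i i< → case i (ℕ.m<1+n⇒m<n∨m≡n i<)
      where
      case : ∀ i → i <ℕ k ⊎ i ≡ k → V i → φ i ≤ x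
      case i (inj₁ i<k)  Vi = max i i<k Vi
      case i (inj₂ refl) Vi with total x (φ i)
      ... | inj₁ x≤ = contradiction x≤ x≰
      ... | inj₂ ≤x = ≤x

-- Correctness of the algorithm

module Correctness (ℝ : Reals) {n : ℕ} (f : SetFunction ℝ n)
  (f≥0 : NonNegative ℝ f) (f-submodular : Submodular ℝ f) where
  open Reals ℝ renaming (refl to ≈-refl; sym to ≈-sym; trans to ≈-trans; reflexive to ≈-reflexive)
  open OrderedField ℝ
  open Submodularity ℝ f f≥0 f-submodular
  open Machine ℝ f
  open Hoare ℝ f
  open Best ℝ

  leqʳ-true : ∀ {x y} → ⌊ x ≤? y ⌋ ≡ true → x ≤ y
  leqʳ-true {x} {y} eq with x ≤? y
  ... | yes x≤y = x≤y

  leqʳ-false : ∀ {x y} → ⌊ x ≤? y ⌋ ≡ false → ¬ x ≤ y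
  leqʳ-false {x} {y} eq with x ≤? y
  ... | no x≰y = x≰y

  ≰⇒≥ : ∀ {x y} → ¬ x ≤ y → y ≤ x
  ≰⇒≥ {x} {y} x≰y with total x y
  ... | inj₁ x≤y = contradiction x≤y x≰y
  ... | inj₂ y≤x = y≤x

  keepsNat-put : ∀ a b y → keepsNat a (put b y) ≡ true
  keepsNat-put a true  y = refl
  keepsNat-put a false y = refl

  set-put : ∀ b y s → set (step (put b y) s) ≡ update (set s) y (write b (nat s 2) (set s y))
  set-put true  y s = refl
  set-put false y s = refl

  assign-runs : ∀ b₁ b₂ x y s → (y ≡ᵇ x) ≡ false → nat s 0 ≡ n →
    Runs (assign b₁ b₂ x y) s λ s′ →
      ∀ i → i <ℕ n → member i (set s′ y) ≡ (Bool.if member i (set s x) then b₁ else b₂)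
  assign-runs b₁ b₂ x y s y≢x s0 =
    run-map (λ { (_ , _ , inv) i i<n → inv i i<n (ℕ.m<n⇒m<1+n i<n) })
      (run-for Inv refl refl (keeps 2) (keeps 0) s0 (refl , λ _ _ ()) body)
    where
    keeps : ∀ a → keepsNat a (put b₁ y) ∧ keepsNat a (put b₂ y) ≡ true
    keeps a rewrite keepsNat-put a b₁ y | keepsNat-put a b₂ y = refl
    Done : ℕ → Subset n → Set
    Done k Y = ∀ i → i <ℕ n → i <ℕ k → member i Y ≡ (Bool.if member i (set s x) then b₁ else b₂)
    Inv : ℕ → State → Set
    Inv k s′ = set s′ x ≡ set s x × Done k (set s′ y)
    write-done : ∀ k Y b → (Bool.if member k (set s x) then b₁ else b₂) ≡ b → Done k Y →
                 Done (suc k) (write b k Y)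
    write-done k Y b eq done i i<n i<k with ℕ.m<1+n⇒m<n∨m≡n i<k
    ... | inj₂ refl = trans (member-write Y i<n) (sym eq)
    ... | inj₁ i<k  = trans (member-write-≢ Y (ℕ.>⇒≢ i<k)) (done i i<n i<k)
    put-runs : ∀ k b s′ → nat s′ 2 ≡ k → (Bool.if member k (set s x) then b₁ else b₂) ≡ b →
               Inv k s′ → Inv (suc k) (tick 2 (step (put b y) s′))
    put-runs k b s′ s2 eq (X≡ , done) rewrite set-put b y s′ | s2 =
      trans (update-other (set s′) y x y≢x) X≡ ,
      subst (Done (suc k)) (sym (update-same (set s′) y)) (write-done k (set s′ y) b eq done)
    body : ∀ k s′ → k ≤ℕ n → nat s′ 0 ≡ n → nat s′ 2 ≡ k → Inv k s′ →
      Runs (if mem (cell 2) (cell x) then exec (put b₁ y) else exec (put b₂ y)) s′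
        λ s″ → Inv (suc k) (tick 2 s″)
    body k s′ _ _ s2 inv@(X≡ , _) = run-if
      (λ eq → run-exec (put-runs k b₁ s′ s2 (cong (Bool.if_then b₁ else b₂) (at-k eq)) inv))
      (λ eq → run-exec (put-runs k b₂ s′ s2 (cong (Bool.if_then b₁ else b₂) (at-k eq)) inv))
      where
      at-k : ∀ {b} → member (nat s′ 2) (set s′ x) ≡ b → member k (set s x) ≡ b
      at-k eq = trans (sym (cong₂ member s2 X≡)) eq

  copy-runs : ∀ x y s → (y ≡ᵇ x) ≡ false → nat s 0 ≡ n →
    Runs (assign true false x y) s λ s′ → set s′ y ≡ set s x
  copy-runs x y s y≢x s0 = run-map (λ eq → member-ext λ i i<n → trans (eq i i<n) (if-eta (member i (set s x))))
    (assign-runs true false x y s y≢x s0)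
    where
    if-eta : ∀ b → (Bool.if b then true else false) ≡ b
    if-eta true  = refl
    if-eta false = refl

  -- Invariant: either size `c` has been reached, or no index passed so far is missing. In the
  -- second case the final set is all of `V`, and `c ≤ n` forces its size to be `c`.
  fill-runs : ∀ s c → nat s 0 ≡ n → nat s 1 ≡ c → c ≤ℕ n → nat s 6 ≡ ∣ set s 2 ∣ → ∣ set s 2 ∣ ≤ℕ c →
    Runs fill s λ s′ → ∣ set s′ 2 ∣ ≡ c × (∀ i → i ∈ set s 2 → i ∈ set s′ 2)
  fill-runs s c s0 s1 c≤n s6 ≤c = run-map (λ {s′} → final s′)
    (run-for Inv refl refl refl refl s0 (s1 , s6 , ≤c , (λ _ i∈ → i∈) , inj₂ λ _ _ ()) body)
    where
    Inv : ℕ → State → Set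
    Inv k s′ = nat s′ 1 ≡ c × nat s′ 6 ≡ ∣ set s′ 2 ∣ × ∣ set s′ 2 ∣ ≤ℕ c ×
               (∀ i → i ∈ set s 2 → i ∈ set s′ 2) ×
               (c ≤ℕ ∣ set s′ 2 ∣ ⊎ (∀ i → i <ℕ n → i <ℕ k → i ∈ set s′ 2))
    final : ∀ s′ → nat s′ 0 ≡ n × Inv (suc n) s′ →
            ∣ set s′ 2 ∣ ≡ c × (∀ i → i ∈ set s 2 → i ∈ set s′ 2)
    final _ (_ , _ , _ , ≤c , ⊇ , inj₁ c≤) = ℕ.≤-antisym ≤c c≤ , ⊇
    final s′ (_ , _ , _ , ≤c , ⊇ , inj₂ full) = ℕ.≤-antisym ≤c
      (ℕ.≤-trans c≤n (ℕ.≤-reflexive (sym (∣full∣ (set s′ 2) λ i i<n → full i i<n (ℕ.m<n⇒m<1+n i<n))))) , ⊇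
    body : ∀ k s′ → k ≤ℕ n → nat s′ 0 ≡ n → nat s′ 2 ≡ k → Inv k s′ → Runs _ s′ λ s″ → Inv (suc k) (tick 2 s″)
    body k s′ k≤n _ s2 (s1 , s6 , ≤c , ⊇ , done) = run-if
      (λ eq → run-skip (s1 , s6 , ≤c , ⊇ , inj₁ (subst₂ _≤ℕ_ s1 s6 (≤ᵇ≡true⇒≤ eq))))
      (λ c≰ → let <c = subst₂ _<ℕ_ s6 s1 (≤ᵇ≡false⇒> c≰) in
        run-if
          (λ eq → run-skip (s1 , s6 , ≤c , ⊇ , keep done (trans (cong (λ j → member j (set s′ 2)) (sym s2)) eq)))
          (λ eq → add-element <c (trans (cong (λ j → member j (set s′ 2)) (sym s2)) eq)))
      where
      X = set s′ 2
      keep : c ≤ℕ ∣ X ∣ ⊎ (∀ i → i <ℕ n → i <ℕ k → i ∈ X) → k ∈ X →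
             c ≤ℕ ∣ X ∣ ⊎ (∀ i → i <ℕ n → i <ℕ suc k → i ∈ X)
      keep (inj₁ c≤)   _   = inj₁ c≤
      keep (inj₂ full) k∈X = inj₂ λ i i<n i<1+k → case i i<n (ℕ.m<1+n⇒m<n∨m≡n i<1+k)
        where
        case : ∀ i → i <ℕ n → i <ℕ k ⊎ i ≡ k → i ∈ X
        case i i<n (inj₁ i<k)  = full i i<n i<k
        case i i<n (inj₂ refl) = k∈X
      -- The index n is not reached with ∣ X ∣ < c, because X is full by then.
      k<n : ∣ X ∣ <ℕ c → k <ℕ n
      k<n <c = case (ℕ.m≤n⇒m<n∨m≡n k≤n) done
        where
        case : k <ℕ n ⊎ k ≡ n → c ≤ℕ ∣ X ∣ ⊎ (∀ i → i <ℕ n → i <ℕ k → i ∈ X) → k <ℕ n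
        case (inj₁ k<n) _           = k<n
        case (inj₂ _)   (inj₁ c≤)   = contradiction c≤ (ℕ.<⇒≱ <c)
        case (inj₂ k≡n) (inj₂ full) = contradiction
          (ℕ.≤-trans c≤n (ℕ.≤-reflexive (sym (∣full∣ X λ i i<n →
            full i i<n (ℕ.<-≤-trans i<n (ℕ.≤-reflexive (sym k≡n))))))) (ℕ.<⇒≱ <c)
      add-element : ∣ X ∣ <ℕ c → k ∉ X → Runs _ s′ λ s″ → Inv (suc k) (tick 2 s″)
      add-element <c k∉X = run-seq (run-exec (run-seq (run-exec (run-exec
        (s1 , trans (cong (_+ℕ 1) s6) (trans (ℕ.+-comm _ 1) (sym size)) ,
         subst (_≤ℕ c) (sym size) <c ,
         (λ i i∈ → written i (⊇ i i∈)) ,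
         grown done)))))
        where
        X′ = write true (nat s′ 2) X
        size : ∣ X′ ∣ ≡ suc ∣ X ∣
        size rewrite s2 = ∣insert∣ X (k<n <c) k∉X
        written : ∀ i → i ∈ X → i ∈ X′
        written i i∈X rewrite s2 with k ℕ.≟ i
        ... | yes refl = member-write X (k<n <c)
        ... | no k≢i   = trans (member-write-≢ X k≢i) i∈X
        grown : c ≤ℕ ∣ X ∣ ⊎ (∀ i → i <ℕ n → i <ℕ k → i ∈ X) →
                c ≤ℕ ∣ X′ ∣ ⊎ (∀ i → i <ℕ n → i <ℕ suc k → i ∈ X′)
        grown (inj₁ c≤)   = contradiction c≤ (ℕ.<⇒≱ <c)
        grown (inj₂ full) = inj₂ λ i i<n i<1+k → case i i<n (ℕ.m<1+n⇒m<n∨m≡n i<1+k)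
          where
          case : ∀ i → i <ℕ n → i <ℕ k ⊎ i ≡ k → i ∈ X′
          case i i<n (inj₁ i<k)  = written i (full i i<n i<k)
          case i i<n (inj₂ refl) rewrite s2 = member-write X i<n

  -- Dual to `fill-runs`: if the size never came down to `c` earlier, every element has been
  -- removed, and the empty set has at most `c` elements.
  trim-runs : ∀ s c → nat s 0 ≡ n → nat s 1 ≡ c → nat s 6 ≡ ∣ set s 2 ∣ → c ≤ℕ ∣ set s 2 ∣ →
    Runs trim s λ s′ → ∣ set s′ 2 ∣ ≡ c × (∀ i → i ∉ set s 2 → i ∉ set s′ 2)
  trim-runs s c s0 s1 s6 c≤ = run-map (λ {s′} → final s′)
    (run-for Inv refl refl refl refl s0 (s1 , s6 , c≤ , (λ _ i∉ → i∉) , inj₂ λ _ ()) body)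
    where
    Inv : ℕ → State → Set
    Inv k s′ = nat s′ 1 ≡ c × nat s′ 6 ≡ ∣ set s′ 2 ∣ × c ≤ℕ ∣ set s′ 2 ∣ ×
               (∀ i → i ∉ set s 2 → i ∉ set s′ 2) ×
               (∣ set s′ 2 ∣ ≤ℕ c ⊎ (∀ i → i <ℕ k → i ∉ set s′ 2))
    final : ∀ s′ → nat s′ 0 ≡ n × Inv (suc n) s′ →
            ∣ set s′ 2 ∣ ≡ c × (∀ i → i ∉ set s 2 → i ∉ set s′ 2)
    final _ (_ , _ , _ , c≤ , ⊆ , inj₁ ≤c) = ℕ.≤-antisym ≤c c≤ , ⊆
    final s′ (_ , _ , _ , c≤ , ⊆ , inj₂ empty) = ℕ.≤-antisym
      (ℕ.≤-trans (ℕ.≤-reflexive (∣empty∣ (set s′ 2) λ i i<n → empty i (ℕ.m<n⇒m<1+n i<n))) z≤n) c≤ , ⊆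
    body : ∀ k s′ → k ≤ℕ n → nat s′ 0 ≡ n → nat s′ 2 ≡ k → Inv k s′ → Runs _ s′ λ s″ → Inv (suc k) (tick 2 s″)
    body k s′ k≤n _ s2 (s1 , s6 , c≤ , ⊆ , done) = run-if
      (λ eq → run-skip (s1 , s6 , c≤ , ⊆ , inj₁ (subst₂ _≤ℕ_ s6 s1 (≤ᵇ≡true⇒≤ eq))))
      (λ ≰c → let c< = subst₂ _<ℕ_ s1 s6 (≤ᵇ≡false⇒> ≰c) in
        run-if
          (λ eq → remove-element c< (trans (cong (λ j → member j X) (sym s2)) eq))
          (λ eq → run-skip (s1 , s6 , c≤ , ⊆ , keep done (trans (cong (λ j → member j X) (sym s2)) eq))))
      where
      X = set s′ 2
      keep : ∣ X ∣ ≤ℕ c ⊎ (∀ i → i <ℕ k → i ∉ X) → k ∉ X →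
             ∣ X ∣ ≤ℕ c ⊎ (∀ i → i <ℕ suc k → i ∉ X)
      keep (inj₁ ≤c)    _   = inj₁ ≤c
      keep (inj₂ empty) k∉X = inj₂ λ i i<1+k → case i (ℕ.m<1+n⇒m<n∨m≡n i<1+k)
        where
        case : ∀ i → i <ℕ k ⊎ i ≡ k → i ∉ X
        case i (inj₁ i<k)  = empty i i<k
        case i (inj₂ refl) = k∉X
      remove-element : c <ℕ ∣ X ∣ → k ∈ X → Runs _ s′ λ s″ → Inv (suc k) (tick 2 s″)
      remove-element c< k∈X = run-seq (run-exec (run-seq (run-exec (run-exec
        (s1 , trans (cong (_∸ 1) s6) (cong (_∸ 1) (sym size)) ,
         ℕ.≤-pred (subst (c <ℕ_) (sym size) c<) ,
         (λ i i∉ → erased i (⊆ i i∉)) ,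
         shrunk done)))))
        where
        X′ = write false (nat s′ 2) X
        size : suc ∣ X′ ∣ ≡ ∣ X ∣
        size rewrite s2 = ∣delete∣ X k∈X
        erased : ∀ i → i ∉ X → i ∉ X′
        erased i i∉X rewrite s2 with k ℕ.≟ i
        ... | yes refl = contradiction (trans (sym k∈X) i∉X) λ ()
        ... | no k≢i   = trans (member-write-≢ X k≢i) i∉X
        shrunk : ∣ X ∣ ≤ℕ c ⊎ (∀ i → i <ℕ k → i ∉ X) →
                 ∣ X′ ∣ ≤ℕ c ⊎ (∀ i → i <ℕ suc k → i ∉ X′)
        shrunk (inj₁ ≤c)    = contradiction ≤c (ℕ.<⇒≱ c<)
        shrunk (inj₂ empty) = inj₂ λ i i<1+k → case i (ℕ.m<1+n⇒m<n∨m≡n i<1+k)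
          where
          case : ∀ i → i <ℕ k ⊎ i ≡ k → i ∉ X′
          case i (inj₁ i<k)  = erased i (empty i i<k)
          case i (inj₂ refl) rewrite s2 = member-write X (∈⇒< X k∈X)

  -- One improvement step

  Deletable Insertable : Subset n → Subset n → ℕ → Set
  Deletable  U X i = i ∈ U × i ∈ X
  Insertable U X i = i ∈ U × i ∉ X

  after-delete after-insert : Subset n → ℕ → Carrier
  after-delete X i = f (write false i X)
  after-insert X i = f (write true i X)

  Scanned : Subset n → Subset n → ℕ → State → Set
  Scanned U X k s = set s 2 ≡ X × set s 3 ≡ U ×
    Best n (Deletable U X) (after-delete X) k (nat s 4) (real s 1) ×
    Best n (Insertable U X) (after-insert X) k (nat s 5) (real s 2)

  scan-element-runs : ∀ U X k s → nat s 2 ≡ k → Scanned U X k s →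
    Runs scan-element s λ s′ → Scanned U X (suc k) (tick 2 s′)
  scan-element-runs U X k s s2 (X≡ , U≡ , bestA , bestB) = run-if
    (λ k∈U → run-if (λ k∈X → deletable (at-k U≡ k∈U) (at-k X≡ k∈X))
                    (λ k∉X → insertable (at-k U≡ k∈U) (at-k X≡ k∉X)))
    (λ k∉U → let k∉U = at-k U≡ k∉U in run-skip (X≡ , U≡ ,
      best-skip (λ (k∈U , _) → absurd k∈U k∉U) bestA ,
      best-skip (λ (k∈U , _) → absurd k∈U k∉U) bestB))
    where
    at-k : ∀ {Y Z b} → Y ≡ Z → member (nat s 2) Y ≡ b → member k Z ≡ b
    at-k Y≡Z eq = trans (sym (cong₂ member s2 Y≡Z)) eq
    absurd : ∀ {b} {A : Set} → b ≡ true → b ≡ false → A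
    absurd refl ()
    restore : ∀ b b′ → member k X ≡ b → write b (nat s 2) (write b′ (nat s 2) (set s 2)) ≡ X
    restore b b′ eq rewrite s2 | X≡ = write-restore b b′ k X eq
    value≡ : ∀ b → f (write b (nat s 2) (set s 2)) ≡ f (write b k X)
    value≡ b = cong₂ (λ j Y → f (write b j Y)) s2 X≡
    deletable : k ∈ U → k ∈ X → Runs _ s λ s′ → Scanned U X (suc k) (tick 2 s′)
    deletable k∈U k∈X = run-seq (run-exec (run-seq (run-exec (run-seq (run-exec (run-if
      (λ p≤ → run-seq (run-exec (run-exec (restore true false k∈X , U≡ ,
        subst₂ (Best n (Deletable U X) (after-delete X) (suc k)) (sym s2) (sym (value≡ false))
          (best-take (k∈U , k∈X) (subst (_ ≤_) (value≡ false) (leqʳ-true p≤)) bestA) ,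
        skipB))))
      (λ p≰ → run-skip (restore true false k∈X , U≡ ,
        best-keep (f≥0 _) (subst (λ y → ¬ _ ≤ y) (value≡ false) (leqʳ-false p≰)) bestA ,
        skipB))))))))
      where
      skipB = best-skip (λ (_ , k∉X) → absurd k∈X k∉X) bestB
    insertable : k ∈ U → k ∉ X → Runs _ s λ s′ → Scanned U X (suc k) (tick 2 s′)
    insertable k∈U k∉X = run-seq (run-exec (run-seq (run-exec (run-seq (run-exec (run-if
      (λ q≤ → run-seq (run-exec (run-exec (restore false true k∉X , U≡ , skipA ,
        subst₂ (Best n (Insertable U X) (after-insert X) (suc k)) (sym s2) (sym (value≡ true))
          (best-take (k∈U , k∉X) (subst (_ ≤_) (value≡ true) (leqʳ-true q≤)) bestB)))))
      (λ q≰ → run-skip (restore false true k∉X , U≡ , skipA ,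
        best-keep (f≥0 _) (subst (λ y → ¬ _ ≤ y) (value≡ true) (leqʳ-false q≰)) bestB))))))))
      where
      skipA = best-skip (λ (_ , k∈X) → absurd k∈X k∉X) bestA

  scan-runs : ∀ s → nat s 0 ≡ n →
    Runs scan s λ s′ → nat s′ 0 ≡ n × Scanned (set s 3) (set s 2) (suc n) s′
  scan-runs s s0 = run-seq (run-exec (run-seq (run-exec (run-seq (run-exec (run-seq (run-exec
    (run-for (Scanned (set s 3) (set s 2)) refl refl refl refl s0
      (refl , refl , none s0 refl (λ _ ()) , none s0 refl (λ _ ()))
      λ k s′ _ _ s2 → scan-element-runs (set s 3) (set s 2) k s′ s2))))))))

  -- `X` and the swapped set have union `write true b X` and intersection `write false a X`.
  swap-gain : ∀ X a b → a ∈ X → b ∉ X → b <ℕ n →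
    f (write true b X) + f (write false a X) ≤ f X + f (write true b (write false a X))
  swap-gain X a b a∈X b∉X b<n = submodular X _ (member-ext union) (member-ext inter)
    where
    a≢b = ∈∉⇒≢ X a∈X b∉X
    union : ∀ i → i <ℕ n → member i (X ∪ write true b (write false a X)) ≡ member i (write true b X)
    union i i<n rewrite member-∪ i X (write true b (write false a X)) with b ℕ.≟ i
    ... | yes refl
      rewrite member-write {b = true} (write false a X) i<n | member-write {b = true} X i<n | b∉X = refl
    ... | no b≢i rewrite member-write-≢ {b = true} (write false a X) b≢i | member-write-≢ {b = true} X b≢i
      with a ℕ.≟ i
    ...   | yes refl rewrite member-write {b = false} X i<n | a∈X = refl
    ...   | no a≢i rewrite member-write-≢ {b = false} X a≢i with member i X
    ...     | true  = refl
    ...     | false = refl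
    inter : ∀ i → i <ℕ n → member i (X ∩ write true b (write false a X)) ≡ member i (write false a X)
    inter i i<n rewrite member-∩ i X (write true b (write false a X)) with b ℕ.≟ i
    ... | yes refl
      rewrite member-write {b = true} (write false a X) i<n | member-write-≢ {b = false} X a≢b | b∉X = refl
    ... | no b≢i rewrite member-write-≢ {b = true} (write false a X) b≢i with a ℕ.≟ i
    ...   | yes refl rewrite member-write {b = false} X i<n | a∈X = refl
    ...   | no a≢i rewrite member-write-≢ {b = false} X a≢i with member i X
    ...     | true  = refl
    ...     | false = refl

  -- Covers the exits of `swap-best` without a swap: the recorded sum is at most `2 f X`, or no
  -- deletion or no insertion is possible and the hypothesis is vacuous.
  stay : ∀ {U X} → (∀ a b → Deletable U X a → Insertable U X b →
           f (write true b X) + f (write false a X) ≤ f X + f X) → Improves U X X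
  stay opt = record
    { size = refl ; outside = λ _ _ → refl ; ascent = ≤-refl
    ; swap = λ a b a∈U b∈U a∈X b∉X → opt a b (a∈U , a∈X) (b∈U , b∉X) }

  -- By `swap-gain` the new set gains at least the largest sum of two marginal gains, and hence
  -- dominates every pair at once.
  move : ∀ {U X} a b → Deletable U X a → Insertable U X b →
    f X + f X ≤ f (write false a X) + f (write true b X) →
    (∀ a′ b′ → Deletable U X a′ → Insertable U X b′ →
       f (write true b′ X) + f (write false a′ X) ≤ f (write false a X) + f (write true b X)) →
    Improves U X (write true b (write false a X))
  move {U} {X} a b (a∈U , a∈X) (b∈U , b∉X) up max = record
    { size    = trans (∣insert∣ (write false a X) b<n (trans (member-write-≢ X (∈∉⇒≢ X a∈X b∉X)) b∉X))
                      (∣delete∣ X a∈X)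
    ; outside = λ i i∉U → trans (member-write-≢ (write false a X) (∈∉⇒≢ U b∈U i∉U))
                                (member-write-≢ X (∈∉⇒≢ U a∈U i∉U))
    ; ascent  = linear (f X) (≤-trans up gain) ≈-refl (+-comm _ _)
    ; swap    = λ a′ b′ a′∈U b′∈U a′∈X b′∉X → ≤-trans (max a′ b′ (a′∈U , a′∈X) (b′∈U , b′∉X)) gain
    }
    where
    b<n = ∈⇒< U b∈U
    gain : f (write false a X) + f (write true b X) ≤ f X + f (write true b (write false a X))
    gain = ≤-trans (≤-reflexive (+-comm _ _)) (swap-gain X a b a∈X b∉X b<n)

  best-bound : ∀ {V φ a x} → Best n V φ (suc n) a x → ∀ i → i <ℕ n → V i → φ i ≤ x
  best-bound (none _ _ empty) i i<n Vi = contradiction Vi (empty i (ℕ.m<n⇒m<1+n i<n))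
  best-bound (some _ _ max)   i i<n Vi = max i (ℕ.m<n⇒m<1+n i<n) Vi

  swap-best-runs : ∀ U X s → nat s 0 ≡ n → Scanned U X (suc n) s →
    Runs swap-best s λ s′ → Improves U X (set s′ 2)
  swap-best-runs U X s s0 (X≡ , U≡ , bestA , bestB) =
    run-seq (run-exec (run-seq (run-exec (run-seq (run-exec (run-if
      (λ ≤2fX → run-skip (subst (Improves U X) (sym X≡) (stay λ a b da ib →
        ≤-trans (bound a b da ib) (subst (λ Y → _ ≤ f Y + f Y) X≡ (leqʳ-true ≤2fX)))))
      (λ ≰2fX → run-if (λ n≤a → run-skip (no-delete bestA (≤ᵇ≡true⇒≤ n≤a)))
        (λ n≰a → run-if (λ n≤b → run-skip (no-insert bestB (≤ᵇ≡true⇒≤ n≤b)))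
          (λ n≰b → run-seq (run-exec (run-exec
            (do-swap bestA bestB (≤ᵇ≡false⇒> n≰a) (≤ᵇ≡false⇒> n≰b)
              (subst (λ Y → f Y + f Y ≤ _) X≡ (≰⇒≥ (leqʳ-false ≰2fX)))))))))))))))
    where
    a = nat s 4
    b = nat s 5
    bound : ∀ a b → Deletable U X a → Insertable U X b →
            f (write true b X) + f (write false a X) ≤ real s 1 + real s 2
    bound a b da ib = ≤-trans (≤-reflexive (+-comm _ _))
      (+-mono-≤ (best-bound bestA a (∈⇒< U (proj₁ da)) da) (best-bound bestB b (∈⇒< U (proj₁ ib)) ib))
    no-delete : Best n (Deletable U X) (after-delete X) (suc n) a (real s 1) → nat s 0 ≤ℕ a →
                Improves U X (set s 2)
    no-delete (none _ _ empty) _ = subst (Improves U X) (sym X≡)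
      (stay λ a b da _ → contradiction da (empty a (ℕ.m<n⇒m<1+n (∈⇒< U (proj₁ da)))))
    no-delete (some (a∈U , _) _ _) n≤a =
      contradiction (∈⇒< U a∈U) (ℕ.≤⇒≯ (ℕ.≤-trans (ℕ.≤-reflexive (sym s0)) n≤a))
    no-insert : Best n (Insertable U X) (after-insert X) (suc n) b (real s 2) → nat s 0 ≤ℕ b →
                Improves U X (set s 2)
    no-insert (none _ _ empty) _ = subst (Improves U X) (sym X≡)
      (stay λ a b _ ib → contradiction ib (empty b (ℕ.m<n⇒m<1+n (∈⇒< U (proj₁ ib)))))
    no-insert (some (b∈U , _) _ _) n≤b =
      contradiction (∈⇒< U b∈U) (ℕ.≤⇒≯ (ℕ.≤-trans (ℕ.≤-reflexive (sym s0)) n≤b))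
    do-swap : Best n (Deletable U X) (after-delete X) (suc n) a (real s 1) →
              Best n (Insertable U X) (after-insert X) (suc n) b (real s 2) →
              a <ℕ nat s 0 → b <ℕ nat s 0 → f X + f X ≤ real s 1 + real s 2 →
              Improves U X (write true b (write false a (set s 2)))
    do-swap (none a≡n _ _) _ a<n _ _ = contradiction (trans a≡n (sym s0)) (ℕ.<⇒≢ a<n)
    do-swap _ (none b≡n _ _) _ b<n _ = contradiction (trans b≡n (sym s0)) (ℕ.<⇒≢ b<n)
    do-swap (some da p≡ _) (some ib q≡ _) _ _ up =
      subst (λ Y → Improves U X (write true b (write false a Y))) (sym X≡)
        (move a b da ib (subst₂ (λ p q → f X + f X ≤ p + q) p≡ q≡ up)
          λ a′ b′ da′ ib′ → subst₂ (λ p q → _ ≤ p + q) p≡ q≡ (bound a′ b′ da′ ib′))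

  record Advanced (s s′ : State) : Set where
    field
      improves  : Improves (set s 3) (set s 2) (set s′ 2)
      size-out  : ∣ set s′ 0 ∣ ≡ ∣ set s 2 ∣
      current≤  : f (set s′ 2) ≤ f (set s′ 0)
      previous≤ : f (set s 0) ≤ f (set s′ 0)

  advance-runs : ∀ s → nat s 0 ≡ n → ∣ set s 0 ∣ ≡ ∣ set s 2 ∣ → Runs advance s (Advanced s)
  advance-runs s s0 ∣out∣ =
    run-seq (run-map (λ {s₁} ((s₁0 , scanned) , frame₁) →
      run-seq (run-map (λ {s₂} (imp , frame₂) →
        let out≡ = trans (keep-set frame₂ 0 refl) (keep-set frame₁ 0 refl)
            s₂0  = trans (keep-nat frame₂ 0 refl) s₁0 in
        run-seq (run-exec (run-seq (run-exec (run-if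
          (λ X≤out → run-skip (record
            { improves = imp ; size-out = trans (cong ∣_∣ out≡) ∣out∣
            ; current≤ = leqʳ-true X≤out ; previous≤ = ≤-reflexive (≈-reflexive (cong f (sym out≡))) }))
          (λ X≰out → run-map (λ (copied , frame₃) →
              let X≡ = keep-set frame₃ 2 refl
                  out≡X = trans copied (sym X≡) in record
            { improves = subst (Improves _ _) (sym X≡) imp
            ; size-out = trans (cong ∣_∣ copied) (Improves.size imp)
            ; current≤ = ≤-reflexive (≈-reflexive (cong f (sym out≡X)))
            ; previous≤ = subst₂ (λ Y Z → f Y ≤ f Z) out≡ (sym copied) (≰⇒≥ (leqʳ-false X≰out)) })
            (run-frame (copy-runs 2 0 _ refl s₂0))))))))
        (run-frame (swap-best-runs (set s 3) (set s 2) s₁ s₁0 scanned))))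
      (run-frame (scan-runs s s0)))

  -- The two nested searches

  restart-runs : ∀ s c → c ≤ℕ n → nat s 0 ≡ n → nat s 1 ≡ c → ∣ set s 1 ∣ ≡ c →
    Runs restart s λ s′ → ∣ set s′ 2 ∣ ≡ c × ∃ λ σ → Opposite σ (set s 1) (set s′ 3) (set s′ 2)
  restart-runs s c c≤n s0 s1 ∣R∣≡c =
    run-seq (run-map (λ {s₁} (compl , frame₁) →
      let s₁0    = trans (keep-nat frame₁ 0 refl) s0
          s₁1    = trans (keep-nat frame₁ 1 refl) s1
          R≡     = keep-set frame₁ 1 refl
          R⇒X    = λ {b} i i<n (Ri : member i R ≡ b) → trans (compl i i<n) (cong (Bool.if_then false else true) Ri)
          n-c≡∣X∣ = size-complement s₁ compl s₁0 s₁1 in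
      run-seq (run-exec (run-if
        (λ k≤c → run-seq (run-map (λ {s₂} (copied , frame₂) →
          let X≡ = keep-set frame₂ 2 refl in
          run-map (λ ((∣X∣≡c , ⊇) , frame₃) →
            let U≡R = trans (keep-set frame₃ 3 refl) (trans copied R≡) in
            ∣X∣≡c , false , record
              { pinned = λ i i<n Ri → trans (cong (member i) U≡R) Ri ,
                  ⊇ i (trans (cong (member i) X≡) (R⇒X i i<n Ri))
              ; free   = λ i i<n Ri → trans (cong (member i) U≡R) Ri })
            (run-frame (fill-runs s₂ c (trans (keep-nat frame₂ 0 refl) s₁0)
              (trans (keep-nat frame₂ 1 refl) s₁1) c≤n
              (trans (keep-nat frame₂ 6 refl) (trans n-c≡∣X∣ (cong ∣_∣ (sym X≡))))
              (subst₂ _≤ℕ_ (trans n-c≡∣X∣ (cong ∣_∣ (sym X≡))) s₁1 (≤ᵇ≡true⇒≤ k≤c)))))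
          (run-frame (copy-runs 1 3 _ refl s₁0))))
        (λ k≰c → run-seq (run-map (λ {s₂} (compl₂ , frame₂) →
          let X≡ = keep-set frame₂ 2 refl in
          run-map (λ {s₃} ((∣X∣≡c , ⊆) , frame₃) →
            let R⇒U = λ {b} i i<n (Ri : member i R ≡ b) → trans (cong (member i) (keep-set frame₃ 3 refl))
                        (trans (compl₂ i i<n) (cong (Bool.if_then false else true)
                          (trans (cong (member i) R≡) Ri))) in
            ∣X∣≡c , true , record
              { pinned = λ i i<n Ri → R⇒U i i<n Ri ,
                  ⊆ i (trans (cong (member i) X≡) (R⇒X i i<n Ri))
              ; free   = λ i i<n Ri → R⇒U i i<n Ri })
            (run-frame (trim-runs s₂ c (trans (keep-nat frame₂ 0 refl) s₁0)
              (trans (keep-nat frame₂ 1 refl) s₁1)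
              (trans (keep-nat frame₂ 6 refl) (trans n-c≡∣X∣ (cong ∣_∣ (sym X≡))))
              (ℕ.<⇒≤ (subst₂ _<ℕ_ s₁1 (trans n-c≡∣X∣ (cong ∣_∣ (sym X≡))) (≤ᵇ≡false⇒> k≰c))))))
          (run-frame (assign-runs false true 1 3 _ refl s₁0)))))))
      (run-frame (assign-runs false true 1 2 s refl s0)))
    where
    R = set s 1
    size-complement : ∀ s₁ →
      (∀ i → i <ℕ n → member i (set s₁ 2) ≡ (Bool.if member i R then false else true)) →
      nat s₁ 0 ≡ n → nat s₁ 1 ≡ c → nat s₁ 0 ∸ nat s₁ 1 ≡ ∣ set s₁ 2 ∣
    size-complement s₁ compl s₁0 s₁1 = trans (cong₂ _∸_ s₁0 s₁1)
      (trans (cong₂ _∸_ (sym (∣complement∣ R (set s₁ 2) λ i i<n →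
                          trans (compl i i<n) (if≡not (member i R)))) (sym ∣R∣≡c))
             (ℕ.m+n∸m≡n ∣ R ∣ _))
      where
      if≡not : ∀ b → (Bool.if b then false else true) ≡ not b
      if≡not true  = refl
      if≡not false = refl

  -- The set that the search starts from has not been compared with the best set, so
  -- `f (set s 2) ≤ f (set s 0)` is claimed only after a first round. `out` is the best set before
  -- the search.
  Round₂ : ℕ → Subset n → Subset n → ℕ → State → Set
  Round₂ c R out u s =
    nat s 1 ≡ c × ∣ set s 0 ∣ ≡ c × ∣ set s 2 ∣ ≡ c × set s 1 ≡ R ×
    (∃ λ σ → Opposite σ R (set s 3) (set s 2)) ×
    f out ≤ f (set s 0) × (1 ≤ℕ u → f (set s 2) ≤ f (set s 0)) ×
    (∀ C → ∣ C ∣ ≡ c →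
      Averaged u (f C) ((f (R ∪ C) + f (R ∩ C)) + (f (set s 0) + f (set s 0))) c (f (set s 2)))

  phase₂-runs : ∀ s c → c ≤ℕ n → nat s 0 ≡ n → nat s 1 ≡ c → ∣ set s 0 ∣ ≡ c → ∣ set s 2 ∣ ≡ c →
    (∃ λ σ → Opposite σ (set s 1) (set s 3) (set s 2)) →
    Runs (for 7 advance) s λ s′ →
      ∣ set s′ 0 ∣ ≡ c × f (set s 0) ≤ f (set s′ 0) ×
      (∀ C → ∣ C ∣ ≡ c → f C ≤
        (f (set s 1 ∪ C) + f (set s 1 ∩ C)) + (f (set s′ 0) + f (set s′ 0)) + f (set s′ 0))
  phase₂-runs s c c≤n s0 s1 ∣out∣≡c ∣X∣≡c opp = run-map
    (λ {s′} (_ , _ , ∣out∣≡c , _ , _ , _ , out≤ , X≤ , avg) →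
      ∣out∣≡c , out≤ , λ C ∣C∣≡c →
        -- `n + 1` rounds have been made and `c ≤ n + 1`, so the averaged error costs one more copy
        -- of the best value.
        averaged⇒≤ n _ _ c (ℕ.m≤n⇒m≤1+n c≤n) (f≥0 _) (X≤ (s≤s z≤n)) (avg C ∣C∣≡c))
    (run-for (Round₂ c (set s 1) (set s 0)) refl refl refl refl s0
      (s1 , ∣out∣≡c , ∣X∣≡c , refl , opp , ≤-refl , (λ ()) , λ C _ → averaged-zero _ _ c (f≥0 _))
      body)
    where
    R = set s 1
    body : ∀ u s₁ → u ≤ℕ n → nat s₁ 0 ≡ n → nat s₁ 7 ≡ u → Round₂ c R (set s 0) u s₁ →
           Runs advance s₁ λ s₂ → Round₂ c R (set s 0) (suc u) (tick 7 s₂)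
    body u s₁ _ s₁0 _ (s₁1 , ∣out∣≡c , ∣X∣≡c , R≡ , (σ , opp) , out≤ , _ , avg) =
      run-map (λ {s₂} (adv , frame) →
        let imp = Advanced.improves adv
            ascent = ≤-trans (Improves.ascent imp) (Advanced.current≤ adv) in
        trans (keep-nat frame 1 refl) s₁1 ,
        trans (Advanced.size-out adv) ∣X∣≡c ,
        trans (Improves.size imp) ∣X∣≡c ,
        trans (keep-set frame 1 refl) R≡ ,
        (σ , subst (λ U → Opposite σ R U (set s₂ 2)) (sym (keep-set frame 3 refl)) (opposite-step opp imp)) ,
        ≤-trans out≤ (Advanced.previous≤ adv) ,
        (λ _ → Advanced.current≤ adv) ,
        λ C ∣C∣≡c → averaged-suc u _ _ c
          -- The best value may have grown, so the bound from the earlier rounds is first relaxed to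
          -- the new one.
          (averaged-mono u _ c (+-mono-≤ ≤-refl (+-mono-≤ (Advanced.previous≤ adv) (Advanced.previous≤ adv)))
            (avg C ∣C∣≡c))
          (≤-trans (improvement-opposite σ opp imp C c ∣X∣≡c ∣C∣≡c)
            (+-mono-≤ (+-mono-≤ ≤-refl (+-mono-≤ ascent ascent)) ≤-refl)))
      (run-frame (advance-runs s₁ s₁0 (trans ∣out∣≡c (sym ∣X∣≡c))))

  -- Two copies pay for `S₁` and three for the second search, one of these for its averaged error.
  -- Averaging the first search adds the sixth.
  five : Carrier → Carrier
  five x = ((x + x) + (x + x)) + x

  five-mono : ∀ {x y} → x ≤ y → five x ≤ five y
  five-mono x≤y = +-mono-≤ (+-mono-≤ (+-mono-≤ x≤y x≤y) (+-mono-≤ x≤y x≤y)) x≤y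

  Round₁ : ℕ → ℕ → State → Set
  Round₁ c t s =
    nat s 1 ≡ c × ∣ set s 0 ∣ ≡ c × ∣ set s 1 ∣ ≡ c ×
    (1 ≤ℕ t → f (set s 1) ≤ f (set s 0)) ×
    (∀ C → ∣ C ∣ ≡ c → Averaged t (f C) (five (f (set s 0))) c (f (set s 1)))

  -- The bound on `f C` that a completed second search yields; the last `f out` is its averaged
  -- error.
  Gain : Subset n → Subset n → Subset n → Carrier
  Gain R C out = (f (R ∪ C) + f (R ∩ C)) + (f out + f out) + f out

  -- `E` stands for `f (R ∪ C) + f (R ∩ C)`. The second search bounds `F` in terms of `E`, the
  -- advance of `R` bounds `E` itself, and adding the two cancels it.
  combine : ∀ F E b k k′ {r B} → F ≤ E + (b + b) + b → E + k ≤ (r + r) + k′ → r ≤ B → b ≤ B →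
            F + k ≤ five B + k′
  combine F E b k k′ {r} {B} F≤ E≤ r≤B b≤B = linear (E + (b + b) + b + (r + r))
    (+-mono-≤ (+-mono-≤ F≤ E≤) (+-mono-≤ (+-mono-≤ (+-mono-≤ b≤B b≤B) b≤B) (+-mono-≤ r≤B r≤B)))
    (solve 5 (λ F E b k r → F :+ k :+ (E :+ (b :+ b) :+ b :+ (r :+ r)) :=
                            F :+ (E :+ k) :+ (b :+ b :+ b :+ (r :+ r)))
       ≈-refl F E b k r)
    (solve 5 (λ E b k r B → E :+ (b :+ b) :+ b :+ (r :+ r :+ k) :+ (B :+ B :+ B :+ (B :+ B)) :=
                            B :+ B :+ (B :+ B) :+ B :+ k :+ (E :+ (b :+ b) :+ b :+ (r :+ r)))
       ≈-refl E b k′ r B)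

  averaged-round : ∀ {t c R R′ U out out₂ out′} → ∣ R ∣ ≡ c →
    (∀ C → ∣ C ∣ ≡ c → Averaged t (f C) (five (f out)) c (f R)) →
    f out ≤ f out₂ → f out₂ ≤ f out′ →
    (∀ C → ∣ C ∣ ≡ c → f C ≤ Gain R C out₂) →
    (∀ i → i <ℕ n → i ∈ U) → Improves U R R′ → f R′ ≤ f out′ →
    ∀ C → ∣ C ∣ ≡ c → Averaged (suc t) (f C) (five (f out′)) c (f R′)
  averaged-round {t} {c} {R} {R′} {U} {out} {out₂} {out′} ∣R∣≡c avg ≤₁ ≤₂ bound full imp R′≤ C ∣C∣≡c =
    averaged-suc t (f C) (five (f out′)) c
      (averaged-mono t (f C) c (five-mono (≤-trans ≤₁ ≤₂)) (avg C ∣C∣≡c))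
      (combine (f C) (f (R ∪ C) + f (R ∩ C)) (f out₂) (ι c * f R) (ι c * f R′)
        (bound C ∣C∣≡c) (improvement-all full imp C c ∣R∣≡c ∣C∣≡c)
        (≤-trans (Improves.ascent imp) R′≤) ≤₂)

  round-runs : ∀ t s c → c ≤ℕ n → nat s 0 ≡ n → Round₁ c t s →
    Runs (restart ⨾ for 7 advance ⨾ assign true false 1 2 ⨾ assign true true 1 3 ⨾
          advance ⨾ assign true false 2 1) s λ s′ → Round₁ c (suc t) (tick 8 s′)
  round-runs t s c c≤n s0 (s1 , ∣out∣≡c , ∣R∣≡c , _ , avg) =
    run-seq (run-map (λ {s₁} ((∣X∣≡c , σ , opp) , fr₁) →
    let out≡₁ = keep-set fr₁ 0 refl
        R≡₁   = keep-set fr₁ 1 refl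
        s₁0   = trans (keep-nat fr₁ 0 refl) s0
        s₁1   = trans (keep-nat fr₁ 1 refl) s1 in
    run-seq (run-map (λ {s₂} ((∣out₂∣≡c , out≤₂ , bound) , fr₂) →
    let R≡₂ = trans (keep-set fr₂ 1 refl) R≡₁
        s₂0 = trans (keep-nat fr₂ 0 refl) s₁0
        s₂1 = trans (keep-nat fr₂ 1 refl) s₁1 in
    run-seq (run-map (λ {s₃} (copied , fr₃) →
    let s₃0 = trans (keep-nat fr₃ 0 refl) s₂0
        s₃1 = trans (keep-nat fr₃ 1 refl) s₂1
        X≡₃ = trans copied R≡₂ in
    run-seq (run-map (λ {s₄} (full , fr₄) →
    let s₄0   = trans (keep-nat fr₄ 0 refl) s₃0
        s₄1   = trans (keep-nat fr₄ 1 refl) s₃1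
        X≡₄   = trans (keep-set fr₄ 2 refl) X≡₃
        out≡₄ = trans (keep-set fr₄ 0 refl) (keep-set fr₃ 0 refl)
        ∣X₄∣≡c = trans (cong ∣_∣ X≡₄) ∣R∣≡c in
    run-seq (run-map (λ {s₅} (adv , fr₅) →
    let s₅0 = trans (keep-nat fr₅ 0 refl) s₄0
        s₅1 = trans (keep-nat fr₅ 1 refl) s₄1
        imp = subst (λ X → Improves (set s₄ 3) X (set s₅ 2)) X≡₄ (Advanced.improves adv) in
    run-map (λ {s₆} (copied₆ , fr₆) →
    let out≡₆ = keep-set fr₆ 0 refl
        s₆1   = trans (keep-nat fr₆ 1 refl) s₅1
        out≤  = subst₂ (λ Y Z → f Y ≤ f Z) out≡₄ (sym out≡₆) (Advanced.previous≤ adv)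
        X≤    = subst₂ (λ Y Z → f Y ≤ f Z) (sym copied₆) (sym out≡₆) (Advanced.current≤ adv) in
      s₆1 ,
      trans (cong ∣_∣ out≡₆) (trans (Advanced.size-out adv) ∣X₄∣≡c) ,
      trans (cong ∣_∣ copied₆) (trans (Improves.size imp) ∣R∣≡c) ,
      (λ _ → X≤) ,
      averaged-round {t} ∣R∣≡c avg (subst (λ Y → f Y ≤ f (set s₂ 0)) out≡₁ out≤₂) out≤
        (λ C ∣C∣≡c → subst (λ Y → f C ≤ Gain Y C (set s₂ 0)) R≡₁ (bound C ∣C∣≡c))
        -- `assign true true` has set `U` to all of `V`, so this advance of `S₁` is unrestricted.
        (λ i i<n → trans (full i i<n) (if-const (member i (set s₃ 1))))
        (subst (Improves (set s₄ 3) (set s 1)) (sym copied₆) imp) X≤)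
    (run-frame (copy-runs 2 1 s₅ refl s₅0)))
    (run-frame (advance-runs s₄ s₄0 (trans (cong ∣_∣ out≡₄) (trans ∣out₂∣≡c (sym ∣X₄∣≡c)))))))
    (run-frame (assign-runs true true 1 3 s₃ refl s₃0))))
    (run-frame (copy-runs 1 2 s₂ refl s₂0))))
    (run-frame (phase₂-runs s₁ c c≤n s₁0 s₁1 (trans (cong ∣_∣ out≡₁) ∣out∣≡c) ∣X∣≡c
      (σ , subst (λ R → Opposite σ R (set s₁ 3) (set s₁ 2)) (sym R≡₁) opp)))))
    (run-frame (restart-runs s c c≤n s0 s1 ∣R∣≡c)))
    where
    if-const : ∀ b → (Bool.if b then true else true) ≡ true
    if-const true  = refl
    if-const false = refl
  algorithm-runs : ∀ c → c ≤ℕ n → Runs algorithm (initial c) λ s →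
    ∣ output s ∣ ≡ c × (∀ C → ∣ C ∣ ≡ c → f C ≤ ι 6 * f (output s))
  algorithm-runs c c≤n =
    run-seq (run-map (λ {s₁} ((∣X∣≡c , _) , fr₁) →
    let s₁0 = keep-nat fr₁ 0 refl
        s₁1 = keep-nat fr₁ 1 refl in
    run-seq (run-map (λ {s₂} (copied₂ , fr₂) →
    let s₂0 = trans (keep-nat fr₂ 0 refl) s₁0
        s₂1 = trans (keep-nat fr₂ 1 refl) s₁1 in
    run-seq (run-map (λ {s₃} (copied₃ , fr₃) →
    let s₃0 = trans (keep-nat fr₃ 0 refl) s₂0
        s₃1 = trans (keep-nat fr₃ 1 refl) s₂1 in
    run-map (λ {s} (_ , _ , ∣out∣≡c , _ , X≤ , avg) → ∣out∣≡c , λ C ∣C∣≡c →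
        ≤-trans (averaged⇒≤ n _ _ c (ℕ.m≤n⇒m≤1+n c≤n) (f≥0 _) (X≤ (s≤s z≤n)) (avg C ∣C∣≡c))
          (≤-reflexive (solve 1 (λ x → x :+ x :+ (x :+ x) :+ x :+ x :=
            -- The nested sum mirrors the unfolding of `ι 6`.
            (con 1 :+ (con 1 :+ (con 1 :+ (con 1 :+ (con 1 :+ (con 1 :+ con 0)))))) :* x)
            ≈-refl (f (output s)))))
    (run-for (Round₁ c) refl refl refl refl s₃0
      (s₃1 , trans (cong ∣_∣ (trans (keep-set fr₃ 0 refl) copied₂)) ∣X∣≡c ,
       trans (cong ∣_∣ (trans copied₃ (keep-set fr₂ 2 refl))) ∣X∣≡c ,
       (λ ()) , λ C _ → averaged-zero _ _ c (f≥0 _))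
      λ t s _ s0 _ → round-runs t s c c≤n s0))
    (run-frame (copy-runs 2 1 s₂ refl s₂0))))
    (run-frame (copy-runs 2 0 s₁ refl s₁0))))
    (run-frame (fill-runs (initial c) c refl refl c≤n (sym (∣⊥∣≡0 n)) (ℕ.≤-trans (ℕ.≤-reflexive (∣⊥∣≡0 n)) z≤n))))

-- From the factor six to the approximation guarantee

module Approximation (ℝ : Reals) where
  open Reals ℝ renaming (refl to ≈-refl; sym to ≈-sym; trans to ≈-trans; reflexive to ≈-reflexive)
  open OrderedField ℝ
  open Maximum ℝ
  open Machine ℝ using (output; initial)

  SixApproximates : Program → Set
  SixApproximates p = ∀ n (f : SetFunction ℝ n) → NonNegative ℝ f → Submodular ℝ f →
    ∀ c → c ≤ℕ n → Hoare.Runs ℝ f p (initial f c) λ s →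
      ∣ output f s ∣ ≡ c × (∀ C → ∣ C ∣ ≡ c → f C ≤ ι 6 * f (output f s))

  attained : ∀ {n} (f : SetFunction ℝ n) c S → ∣ S ∣ ≡ c → ∃ (IsMaximumOver ℝ f λ T → ∣ T ∣ ≡ c)
  attained f c S ∣S∣≡c with maximum f (λ T → ∣ T ∣ ≡ c) (λ T → ∣ T ∣ ℕ.≟ c)
  ... | inj₁ none    = contradiction ∣S∣≡c (none S)
  ... | inj₂ maximal = maximal

  approximation : ∀ p {ε} → 0# ≤ ε → SixApproximates p →
                  IsPolynomialTimeApproximation ℝ (ι 6 ⁻¹ - ε) p
  approximation p 0≤ε runs = length p , nesting p , λ n f f≥0 f-submodular c c≤n →
    let s , t , run , t≤ , ∣out∣≡c , bound = runs n f f≥0 f-submodular c c≤n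
        -- The output itself witnesses that sets of size `c` exist, so the maximum is attained.
        M , (T , ∣T∣≡c , fT≈M) , max = attained f c (output f s) ∣out∣≡c
    in s , t , run , ℕ.≤-trans t≤ (time-polynomial n p) , ∣out∣≡c ,
       M , ((T , ∣T∣≡c , fT≈M) , max) ,
       ⅙-bound 0≤ε (≤-trans (f≥0 T) (≤-reflexive fT≈M))
         (≤-trans (≤-reflexive (≈-sym fT≈M)) (bound T ∣T∣≡c))

corollary23 : (ℝ : Reals) → let open Reals ℝ in
    (ε : Carrier) → 0# < ε →
    ∃ λ A → IsPolynomialTimeApproximation ℝ ((6 · 1#) ⁻¹ - ε) A
corollary23 ℝ ε 0<ε = algorithm , Approximation.approximation ℝ algorithm (proj₁ 0<ε)
  (λ n f f≥0 f-submodular → Correctness.algorithm-runs ℝ f f≥0 f-submodular)
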